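{- For every constant $c>0$ there is a constant $C>0$ such that for every integer $n\ge 1$ there is an integer $r_0=r_0(c,n)$ such that for all integers $r\ge r_0$ the following holds. Let $S$ be a set of $n$ nonempty strings over a totally ordered alphabet, let $s$ be a nonempty string of length $k$ over that alphabet, and consider an $r$-trie for $S$ (with random string priorities). Then each of the three operations (i) searching for $s$ in the $r$-trie, (ii) inserting $s$ into the $r$-trie by the insertion algorithm described in the context, (iii) deleting $s$ from the $r$-trie by the deletion algorithm described in the context, takes time at most $C\,(k+\log n)$ with probability at least $1-n^{ -c}$, where the probability is over the random priorities of the strings in $S$ (and, for an insertion of a new string, also over the random priority given to $s$). In short: for large enough $r$, the time cost of searching, inserting, or deleting a string of length $k$ in an $r$-trie for $n$ strings is at most $O(k+\log n)$ with high probability.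
   Context: Strings are finite sequences of characters from a totally ordered alphabet; $s[i]$ is the $i$-th character of $s$. **Ternary search trie.** A ternary search trie for a finite set $S$ of nonempty strings is a rooted tree in which every node carries a character and has at most one left child, at most one middle child and at most one right child. It is obtained from the standard trie (prefix tree) of $S$ by organizing the children of each trie node as a binary search tree ordered by their characters. The left and right pointers are the child pointers of these binary search trees. The middle child of a node is the root of the binary search tree formed by the trie children of that node. The nodes correspond bijectively to the nonempty prefixes of strings in $S$: the prefix of a node $x$ is the sequence of characters of the nodes on the path from the root to $x$ at which the path leaves by a middle edge, followed by the character of $x$. The node whose prefix is a string $s\in S$ is the terminal node of $s$. **$r$-trie.** Let $r$ be a positive integer. An $r$-trie for $S$ is a ternary search trie for $S$ such that: 1. Each string in $S$ has a random priority, uniformly distributed on $\{1,\dots,r\}$, independently of the other strings; a higher number means a higher priority. 2. Each node has as its priority the highest priority of a string in $S$ that starts with the prefix corresponding to that node. 3. No node has a lower priority than its left or right child. Each node $x$ stores fields *char*, *prio* (its priority), *strPrio* (the priority of the string whose terminal node is $x$, or $0$ if $x$ is not terminal), and pointers *left*, *mid*, *right*. Missing children, and the empty tree, are represented by a sentinel node *nil* with priority $0$. **Search.** Start at the root with the first character of $s$. At a node $x$ with current character $s[i]$: if $s[i]<x.char$ go to the left child; if $s[i]>x.char$ go to the right child; if $s[i]=x.char$ and $i<|s|$, go to the middle child and increase $i$ by one; if $s[i]=x.char$ and $i=|s|$, stop ($s$ is in $S$ iff $x$ is terminal). If the search reaches *nil*, then $s\notin S$. **Rotations.** rotateWithLeft($x$):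 $y\leftarrow x.left$; $x.left\leftarrow y.right$; $y.right\leftarrow x$; return $y$. rotateWithRight($x$) is the mirror image (exchange left and right). **Insertion.** Execute root $\leftarrow$ insert($s$, 1, root), where insert($s,i,x$) does the following. If $x=nil$, let $x$ be a new node with $x.char=s[i]$, $x.prio=x.strPrio=0$ and all three children *nil*. Then: - If $s[i]<x.char$: set $x.left\leftarrow$ insert($s,i,x.left$), and if $x.left.prio>x.prio$ set $x\leftarrow$ rotateWithLeft($x$). - Else if $s[i]>x.char$: set $x.right\leftarrow$ insert($s,i,x.right$), and if $x.right.prio>x.prio$ set $x\leftarrow$ rotateWithRight($x$). - Else: if $i<|s|$ set $x.mid\leftarrow$ insert($s,i+1,x.mid$); otherwise, if $x.strPrio=0$, set $x.strPrio$ to an independent uniformly random integer in $\{1,\dots,r\}$. Then set $x.prio\leftarrow\max(x.strPrio,x.mid.prio)$. Return $x$. **Deletion.** Execute root $\leftarrow$ delete($s$, 1, root), where delete($s,i,x$) returns $x$ if $x=nil$ and otherwise does the following. - If $s[i]<x.char$: set $x.left\leftarrow$ delete($s,i,x.left$). - Else if $s[i]>x.char$: set $x.right\leftarrow$ delete($s,i,x.right$). - Else: if $i<|s|$ set $x.mid\leftarrow$ delete($s,i+1,x.mid$); otherwise set $x.strPrio\leftarrow 0$. Then set $x.prio\leftarrow\max(x.strPrio,x.mid.prio)$ and $x\leftarrow$ heapifyOrDelete($x$). Return $x$. Here heapifyOrDelete($x$) is: if $x.prio<x.left.prio$ or $x.prio<x.right.prio$, then (if $x.left.prio>x.right.prio$: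 $x\leftarrow$ rotateWithLeft($x$) and $x.right\leftarrow$ heapifyOrDelete($x.right$); otherwise: $x\leftarrow$ rotateWithRight($x$) and $x.left\leftarrow$ heapifyOrDelete($x.left$)); else if $x.prio=0$, $x\leftarrow nil$. Return $x$. **Cost model.** Time is counted in elementary operations: comparing two characters or two priorities, reading or writing a field or pointer, creating a node, generating a random priority, and calling a function or returning from it each cost $O(1)$. -}

module Defs where

open import Level using (Level; _⊔_)
open import Data.Bool.Base using (Bool; true; false; if_then_else_; not; _∨_)
open import Data.Fin.Base using (Fin; toℕ)
open import Data.Integer.Base as ℤ using ()
open import Data.List.Base as List using (List; []; _∷_; filter; allFin; cartesianProductWith)
open import Data.List.NonEmpty.Base as List⁺ using (List⁺; _∷_; _∷⁺_; toList)
open import Data.List.Relation.Binary.Prefix.Heterogeneous using (Prefix)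
open import Data.Nat.Base as ℕ using (ℕ; zero; suc; _+_; _*_; _^_; _≤_)
open import Data.Nat.Properties using (_<?_; _≟_)
open import Data.Product.Base using (∃; _×_; _,_)
open import Data.Rational.Base using (ℚ; ↥_; ↧ₙ_)
open import Data.Unit.Base using (⊤; tt)
open import Data.Vec.Base as Vec using (Vec; []; _∷_)
open import Function.Base using (_∘_)
open import Relation.Binary.Core using (Rel)
open import Relation.Binary.Definitions using (tri<; tri≈; tri>)
open import Relation.Binary.PropositionalEquality.Core using (_≡_; _≢_)
open import Relation.Binary.Structures using (IsStrictTotalOrder)
open import Relation.Nullary.Decidable using (does; ¬?)
open import Relation.Unary using (Pred; Decidable)

private
  variable
    a b p : Level

------------------------------------------------------------------------
-- Finite probability

-- All elements of {1,…,r}ⁿ, each listed once; index j : Fin r stands for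
-- the priority 1 + j.

assignments : (n r : ℕ) → List (Vec (Fin r) n)
assignments zero    r = [] ∷ []
assignments (suc n) r = cartesianProductWith _∷_ (allFin r) (assignments n r)

priority : {r : ℕ} → Fin r → ℕ
priority j = suc (toℕ j)

-- For an outcome drawn uniformly from the list Ω, the event P has
-- probability at least 1 - n^(-c).  Let f of the N outcomes violate P and
-- let c = u / v.  The claim f / N ≤ n^(-u/v) is the same as f^v n^u ≤ N^v,
-- which avoids irrational numbers.

WithProbability≥1-_^-_ : {X : Set a} {P : Pred X p} →
                         (n : ℕ) (c : ℚ) → List X → Decidable P → Set
WithProbability≥1-_^-_ n c Ω P? = f ^ v * n ^ u ≤ N ^ v
  where
  f = List.length (filter (¬? ∘ P?) Ω)
  N = List.length Ω
  u = ℤ.∣ ↥ c ∣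
  v = ↧ₙ c

------------------------------------------------------------------------
-- Computations that count elementary operations

record Timed (X : Set a) : Set a where
  constructor _inTime_
  field
    value : X
    time  : ℕ

open Timed public

return : {X : Set a} → X → Timed X
return x = x inTime 0

infixl 1 _>>=_ _>>_

_>>=_ : {X : Set a} {Y : Set b} → Timed X → (X → Timed Y) → Timed Y
m >>= f = value (f (value m)) inTime (time m + time (f (value m)))

_>>_ : {X : Set a} {Y : Set b} → Timed X → Timed Y → Timed Y
m >> m′ = m >>= λ _ → m′

spend : ℕ → Timed ⊤
spend k = tt inTime k

-- One operation for calling a function and one for returning from it.

call : {X : Set a} → Timed X → Timed X
call m = value m inTime (2 + time m)

------------------------------------------------------------------------
-- Tries over a totally ordered alphabet

module RTrie {a ℓ} {A : Set a} {_<_ : Rel A ℓ}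
             (isStrictTotalOrder : IsStrictTotalOrder _≡_ _<_) where

  open IsStrictTotalOrder isStrictTotalOrder using (compare)

  -- Fields of a node: char, prio, strPrio, left, mid, right.

  data Trie : Set a where
    nil  : Trie
    node : A → ℕ → ℕ → Trie → Trie → Trie → Trie

  prio : Trie → ℕ
  prio nil                = 0
  prio (node _ p _ _ _ _) = p

  -- t ∋ w ↦ x : the subtree x of t is rooted at a node whose prefix is w.

  data _∋_↦_ : Trie → List⁺ A → Trie → Set a where
    here  : ∀ {d p sp l m r} →
            node d p sp l m r ∋ List⁺.[ d ] ↦ node d p sp l m r
    left  : ∀ {d p sp l m r w x} → l ∋ w ↦ x → node d p sp l m r ∋ w ↦ x
    mid   : ∀ {d p sp l m r w x} → m ∋ w ↦ x → node d p sp l m r ∋ d ∷⁺ w ↦ x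
    right : ∀ {d p sp l m r w x} → r ∋ w ↦ x → node d p sp l m r ∋ w ↦ x

  -- Only the nodes reached through left and right pointers are siblings.

  data AllSiblings {p} (P : Pred A p) : Pred Trie (a ⊔ p) where
    nil  : AllSiblings P nil
    node : ∀ {d q sp l m r} → P d → AllSiblings P l → AllSiblings P r →
           AllSiblings P (node d q sp l m r)

  _≼_ : Rel (List⁺ A) a
  w ≼ s = Prefix _≡_ (toList w) (toList s)

  -- The order conditions make all nodes of t have distinct prefixes, so
  -- sound and complete together give the bijection between nodes and
  -- nonempty prefixes of strings in S.

  record IsTernarySearchTrie {n} (S : Fin n → List⁺ A) (t : Trie) : Set (a ⊔ ℓ) where
    field
      ordered  : ∀ {w d p sp l m r} → t ∋ w ↦ node d p sp l m r →
                 AllSiblings (λ e → e < d) l × AllSiblings (λ e → d < e) r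
      sound    : ∀ {w x} → t ∋ w ↦ x → ∃ λ i → w ≼ S i
      complete : ∀ {w} i → w ≼ S i → ∃ λ x → t ∋ w ↦ x

  record IsRTrie {n} (S : Fin n → List⁺ A) (π : Fin n → ℕ) (t : Trie) : Set (a ⊔ ℓ) where
    field
      isTernarySearchTrie : IsTernarySearchTrie S t
      strPrio-terminal    : ∀ {w d p sp l m r} → t ∋ w ↦ node d p sp l m r →
                            ∀ i → w ≡ S i → sp ≡ π i
      strPrio-nonterminal : ∀ {w d p sp l m r} → t ∋ w ↦ node d p sp l m r →
                            (∀ i → w ≢ S i) → sp ≡ 0
      prio-upperBound     : ∀ {w d p sp l m r} → t ∋ w ↦ node d p sp l m r →
                            ∀ i → w ≼ S i → π i ≤ p
      prio-attained       : ∀ {w d p sp l m r} → t ∋ w ↦ node d p sp l m r →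
                            ∃ λ i → w ≼ S i × p ≡ π i
      heap                : ∀ {w d p sp l m r} → t ∋ w ↦ node d p sp l m r →
                            prio l ≤ p × prio r ≤ p

  ----------------------------------------------------------------------
  -- The algorithms
  --
  -- The remaining string s[i], …, s[k] is passed as its first character c
  -- and the list cs of the others, so i < |s| means that cs is not empty.
  -- Reading or writing a field, reading s[i], comparing, testing for nil or
  -- for i < |s|, incrementing i, creating a node and generating a random
  -- priority cost one operation each.

  -- Test x = nil, read s[i] and x.char, and test s[i] < x.char.
  test< : Timed ⊤
  test< = spend 4

  -- The same, followed by the test s[i] > x.char with two more reads.
  test<> : Timed ⊤
  test<> = spend 7

  searchFrom : A → List A → Trie → Timed Bool
  searchFrom c cs nil = do
    spend 1                            -- x = nil
    return false
  searchFrom c cs (node d p sp l m r) with compare c d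
  ... | tri< _ _ _ = do
    test<
    spend 1                            -- read x.left
    searchFrom c cs l
  ... | tri> _ _ _ = do
    test<>
    spend 1                            -- read x.right
    searchFrom c cs r
  searchFrom c [] (node d p sp l m r) | tri≈ _ _ _ = do
    test<>
    spend 1                            -- i < |s|
    spend 2                            -- read x.strPrio, compare with 0
    return (not (does (sp ≟ 0)))
  searchFrom c (c′ ∷ cs) (node d p sp l m r) | tri≈ _ _ _ = do
    test<>
    spend 1                            -- i < |s|
    spend 2                            -- read x.mid, increment i
    searchFrom c′ cs m

  search : List⁺ A → Trie → Timed Bool
  search (c ∷ cs) root = call do
    spend 1                            -- read root
    searchFrom c cs root

  -- Both rotations are used only if the child that moves up is not nil.

  rotateWithLeft : Trie → Timed Trie
  rotateWithLeft (node d p sp (node e p′ sp′ l′ m′ r′) m r) = do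
    spend 4                            -- read x.left, y.right; write x.left, y.right
    return (node e p′ sp′ l′ m′ (node d p sp r′ m r))
  rotateWithLeft x = return x

  rotateWithRight : Trie → Timed Trie
  rotateWithRight (node d p sp l m (node e p′ sp′ l′ m′ r′)) = do
    spend 4                            -- read x.right, y.left; write x.right, y.left
    return (node e p′ sp′ (node d p sp l m l′) m′ r′)
  rotateWithRight x = return x

  -- x.prio ← max(x.strPrio, x.mid.prio), where x has the remaining fields given.

  updatePrio : A → ℕ → Trie → Trie → Trie → Timed Trie
  updatePrio d sp l m r = do
    spend 5                            -- read x.strPrio, x.mid, x.mid.prio; compare; write
    return (node d (sp ℕ.⊔ prio m) sp l m r)

  -- q is the random priority that is used if s has none yet.

  mutual

    insertFrom : ℕ → A → List A → Trie → Timed Trie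
    insertFrom q c cs nil = do
      spend 1                          -- x = nil
      spend 7                          -- create x, initialise its six fields
      test<>                           -- s[i] = x.char in the new node
      insertHere q c 0 nil nil nil cs
    insertFrom q c cs (node d p sp l m r) with compare c d
    ... | tri< _ _ _ = do
      test<
      spend 1                          -- read x.left
      l′ ← call (insertFrom q c cs l)
      spend 5                          -- write x.left; read x.left, x.left.prio, x.prio; compare
      if does (p <? prio l′)
        then call (rotateWithLeft (node d p sp l′ m r))
        else return (node d p sp l′ m r)
    ... | tri> _ _ _ = do
      test<>
      spend 1                          -- read x.right
      r′ ← call (insertFrom q c cs r)
      spend 5                          -- write x.right; read x.right, x.right.prio, x.prio; compare
      if does (p <? prio r′)
        then call (rotateWithRight (node d p sp l m r′))
        else return (node d p sp l m r′)
    ... | tri≈ _ _ _ = do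
      test<>
      insertHere q d sp l m r cs

    -- The case s[i] = x.char; the old value of x.prio is not used.

    insertHere : ℕ → A → ℕ → Trie → Trie → Trie → List A → Timed Trie
    insertHere q d sp l m r [] = do
      spend 1                          -- i < |s|
      spend 2                          -- read x.strPrio, compare with 0
      sp′ ← if does (sp ≟ 0)
              then q inTime 2          -- generate q, write x.strPrio
              else return sp
      updatePrio d sp′ l m r
    insertHere q d sp l m r (c′ ∷ cs) = do
      spend 1                          -- i < |s|
      spend 2                          -- read x.mid, compute i + 1
      m′ ← call (insertFrom q c′ cs m)
      spend 1                          -- write x.mid
      updatePrio d sp l m′ r

  insert : ℕ → List⁺ A → Trie → Timed Trie
  insert q (c ∷ cs) root = do
    spend 1                            -- read root
    x ← call (insertFrom q c cs root)
    spend 1                            -- write root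
    return x

  -- In sinkRight and sinkLeft the rotation is written out, with its cost of
  -- 6 operations including call and return, to make the recursion structural.

  mutual

    heapifyOrDelete : A → ℕ → ℕ → Trie → Trie → Trie → Timed Trie
    heapifyOrDelete d p sp l m r = do
      spend 8                          -- two comparisons of x.prio with that of a child
      if does (p <? prio l) ∨ does (p <? prio r)
        then (do
          spend 5                      -- compare x.left.prio with x.right.prio
          if does (prio r <? prio l)
            then sinkRight d p sp l m r
            else sinkLeft d p sp l m r)
        else (do
          spend 2                      -- read x.prio, compare with 0
          return (if does (p ≟ 0) then nil else node d p sp l m r))

    sinkRight : A → ℕ → ℕ → Trie → Trie → Trie → Timed Trie
    sinkRight d p sp nil m r = return (node d p sp nil m r) -- does not occur
    sinkRight d p sp (node e p′ sp′ l′ m′ r′) m r = do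
      spend 6                          -- rotateWithLeft
      spend 1                          -- read x.right
      x ← call (heapifyOrDelete d p sp r′ m r)
      spend 1                          -- write x.right
      return (node e p′ sp′ l′ m′ x)

    sinkLeft : A → ℕ → ℕ → Trie → Trie → Trie → Timed Trie
    sinkLeft d p sp l m nil = return (node d p sp l m nil)  -- does not occur
    sinkLeft d p sp l m (node e p′ sp′ l′ m′ r′) = do
      spend 6                          -- rotateWithRight
      spend 1                          -- read x.left
      x ← call (heapifyOrDelete d p sp l m l′)
      spend 1                          -- write x.left
      return (node e p′ sp′ x m′ r′)

  updatePrioAndHeapify : A → ℕ → Trie → Trie → Trie → Timed Trie
  updatePrioAndHeapify d sp l m r = do
    spend 5                            -- as in updatePrio
    call (heapifyOrDelete d (sp ℕ.⊔ prio m) sp l m r)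

  deleteFrom : A → List A → Trie → Timed Trie
  deleteFrom c cs nil = do
    spend 1                            -- x = nil
    return nil
  deleteFrom c cs (node d p sp l m r) with compare c d
  ... | tri< _ _ _ = do
    test<
    spend 1                            -- read x.left
    l′ ← call (deleteFrom c cs l)
    spend 1                            -- write x.left
    return (node d p sp l′ m r)
  ... | tri> _ _ _ = do
    test<>
    spend 1                            -- read x.right
    r′ ← call (deleteFrom c cs r)
    spend 1                            -- write x.right
    return (node d p sp l m r′)
  deleteFrom c [] (node d p sp l m r) | tri≈ _ _ _ = do
    test<>
    spend 1                            -- i < |s|
    spend 1                            -- write x.strPrio
    updatePrioAndHeapify d 0 l m r
  deleteFrom c (c′ ∷ cs) (node d p sp l m r) | tri≈ _ _ _ = do
    test<>
    spend 1                            -- i < |s|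
    spend 2                            -- read x.mid, compute i + 1
    m′ ← call (deleteFrom c′ cs m)
    spend 1                            -- write x.mid
    updatePrioAndHeapify d sp l m′ r

  delete : List⁺ A → Trie → Timed Trie
  delete (c ∷ cs) root = do
    spend 1                            -- read root
    x ← call (deleteFrom c cs root)
    spend 1                            -- write root
    return x

{-# OPTIONS --safe #-}

-- Order the strings that diverge from s to the right lexicographically, so
-- that the strings closest to s come first.  A node to the right of s on the
-- search path has at least the priority of everything between it and s, so a
-- string attaining the priority of that node is a weak left-to-right maximum
-- of the sequence of priorities, and different nodes give different maxima.
-- The same holds for the nodes below which the nodes of the search path sink
-- during a deletion.  Together with the mirror image, each operation takes
-- time O(k + R + L), where R and L are the numbers of maxima on both sides.
-- For m independent priorities the expectation of 2^R is close to m + 1, and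
-- Markov's inequality gives the tail bound.

module Submission where

open import Defs
open import Level using (_⊔_)
open import Data.Bool.Base using (T; true; false; if_then_else_)
open import Data.Fin.Base using (Fin; zero; suc; toℕ; punchIn; punchOut)
open import Data.Fin.Properties using (punchIn-punchOut; toℕ<n)
open import Data.Integer.Base using (∣_∣)
open import Data.List.Base as List
  using (List; []; _∷_; _++_; map; filter; allFin; cartesianProductWith; cartesianProduct)
open import Data.List.Membership.Propositional using (_∈_)
open import Data.List.Membership.Propositional.Properties using (∈-allFin; ∈-filter⁺)
open import Data.List.NonEmpty.Base as List⁺ using (List⁺; _∷_; _∷⁺_; toList; length)
open import Data.List.Properties
  using ( filter-accept; filter-none; length-++; length-filter; length-map; length-tabulate
        ; map-++; map-cong; map-tabulate; map-∘ )
open import Data.List.Relation.Binary.Lex.Strict as Lex using (Lex-≤; this; next)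
open import Data.List.Relation.Binary.Permutation.Propositional using (↭-sym; ↭⇒↭ₛ)
open import Data.List.Relation.Binary.Permutation.Propositional.Properties using (∈-resp-↭; ↭-length)
open import Data.List.Relation.Binary.Permutation.Setoid.Properties using (Unique-resp-↭)
open import Data.List.Relation.Binary.Prefix.Heterogeneous using (Prefix; []; _∷_)
open import Data.List.Relation.Unary.All as All using ([]; _∷_)
open import Data.List.Relation.Unary.AllPairs as AllPairs using (AllPairs; []; _∷_)
open import Data.List.Relation.Unary.Any using (here; there)
open import Data.List.Relation.Unary.Sorted.TotalOrder.Properties using (Sorted⇒AllPairs)
open import Data.List.Relation.Unary.Unique.Propositional using (Unique)
import Data.List.Relation.Unary.Unique.Propositional.Properties as Unique
import Data.List.Sort as Sort
open import Data.Nat.Base as ℕ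
  using (ℕ; zero; suc; _+_; _*_; _^_; _≤_; _<_; _<ᵇ_; z≤n; s≤s; s≤s⁻¹; >-nonZero)
open import Data.Nat.ListAction using (sum)
open import Data.Nat.ListAction.Properties using (sum-++)
open import Data.Nat.Logarithm using (⌊log₂_⌋; ⌊log₂⌋-mono-≤; ⌊log₂[2^n]⌋≡n)
open import Data.Nat.Properties
open import Data.Nat.Tactic.RingSolver using (solve-∀)
open import Data.Product.Base using (∃; ∃-syntax; _×_; _,_; proj₁; proj₂; swap)
open import Data.Rational.Base using (ℚ; Positive; ↥_; ↧ₙ_)
open import Data.Sum.Base using (_⊎_; inj₁; inj₂; [_,_]′; map₂) renaming (swap to ⊎-swap)
open import Data.Vec.Base using (Vec; []; _∷_; lookup; insertAt)
open import Data.Vec.Properties using (insertAt-lookup; insertAt-punchIn)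
open import Function.Base using (_∘_; id; flip)
open import Function.Definitions using (Injective)
open import Relation.Binary.Bundles using (DecTotalOrder)
import Relation.Binary.Construct.Flip.EqAndOrd as Flip
import Relation.Binary.Construct.On as On
open import Relation.Binary.Core using (Rel)
open import Relation.Binary.Definitions using (tri<; tri≈; tri>)
open import Relation.Binary.PropositionalEquality
open import Relation.Binary.Structures using (IsStrictTotalOrder)
open import Relation.Nullary using (¬_; Dec; yes; no; does; contradiction)
open import Relation.Nullary.Decidable using (True; toWitness; map′; ¬?; _⊎-dec_)
open import Relation.Unary using (Pred; Decidable)

-- Ties leave a choice between several r-tries for the same priorities, and `T` may settle it
-- differently for every outcome. So the times are bounded, for every admissible trie, by numbers
-- that depend on the priorities alone, and only these are averaged. If m distinct priorities come
-- in random order, the j-th is a maximum with probability 1/j, independently of the others, so 2^R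
-- has expectation ∏ (1 + 1/j) = m + 1. With ties these events are dependent; the expectation is
-- therefore bounded by recursion along the sequence, with the running maximum as a parameter. In a
-- deletion the obstacle is that the priority to which a path node falls results from the deletion
-- further down. The strings that diverge from s further down survive and bound this priority from
-- below. They are also closer to s, so they come earlier in the sequence, and the maxima found at
-- different levels add up. An insertion rotates at most once at each node of its path, so its bound
-- is uniform in the priority of s.

-- Finite sums

∑ : ∀ {x} {X : Set x} → List X → (X → ℕ) → ℕ
∑ xs g = sum (map g xs)

module _ {x} {X : Set x} where

  ∑-cong : ∀ {g h : X → ℕ} xs → (∀ y → g y ≡ h y) → ∑ xs g ≡ ∑ xs h
  ∑-cong xs g≗h = cong sum (map-cong g≗h xs)

  ∑-mono : ∀ {g h : X → ℕ} xs → (∀ y → g y ≤ h y) → ∑ xs g ≤ ∑ xs h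
  ∑-mono []       g≤h = z≤n
  ∑-mono (y ∷ xs) g≤h = +-mono-≤ (g≤h y) (∑-mono xs g≤h)

  ∑-+ : ∀ (g h : X → ℕ) xs → ∑ xs (λ y → g y + h y) ≡ ∑ xs g + ∑ xs h
  ∑-+ g h []       = refl
  ∑-+ g h (y ∷ xs) = begin
    g y + h y + ∑ xs (λ z → g z + h z) ≡⟨ cong (g y + h y +_) (∑-+ g h xs) ⟩
    g y + h y + (∑ xs g + ∑ xs h)      ≡⟨ interchange (g y) (h y) (∑ xs g) (∑ xs h) ⟩
    g y + ∑ xs g + (h y + ∑ xs h)      ∎
    where
    open ≡-Reasoning
    interchange : ∀ a b c d → a + b + (c + d) ≡ a + c + (b + d)
    interchange = solve-∀

  ∑-* : ∀ k (g : X → ℕ) xs → ∑ xs (λ y → k * g y) ≡ k * ∑ xs g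
  ∑-* k g []       = sym (*-zeroʳ k)
  ∑-* k g (y ∷ xs) =
    trans (cong (k * g y +_) (∑-* k g xs)) (sym (*-distribˡ-+ k (g y) (∑ xs g)))

  ∑-const : ∀ k (xs : List X) → ∑ xs (λ _ → k) ≡ List.length xs * k
  ∑-const k []       = refl
  ∑-const k (_ ∷ xs) = cong (k +_) (∑-const k xs)

module _ {x y} {X : Set x} {Y : Set y} where

  ∑-swap : ∀ (g : X → Y → ℕ) xs ys →
           ∑ xs (λ u → ∑ ys (g u)) ≡ ∑ ys (λ v → ∑ xs (λ u → g u v))
  ∑-swap g []       ys = sym (trans (∑-const 0 ys) (*-zeroʳ (List.length ys)))
  ∑-swap g (u ∷ xs) ys = trans (cong (∑ ys (g u) +_) (∑-swap g xs ys))
    (sym (∑-+ (g u) (λ v → ∑ xs (λ u → g u v)) ys))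

  ∑-cartesianProductWith :
    ∀ {z} {Z : Set z} (h : X → Y → Z) (g : Z → ℕ) xs ys →
    ∑ (cartesianProductWith h xs ys) g ≡ ∑ xs (λ u → ∑ ys (λ v → g (h u v)))
  ∑-cartesianProductWith h g []       ys = refl
  ∑-cartesianProductWith h g (u ∷ xs) ys = begin
    sum (map g (map (h u) ys ++ rest))    ≡⟨ cong sum (map-++ g (map (h u) ys) rest) ⟩
    sum (map g (map (h u) ys) ++ map g rest)
      ≡⟨ sum-++ (map g (map (h u) ys)) (map g rest) ⟩
    sum (map g (map (h u) ys)) + ∑ rest g
      ≡⟨ cong₂ _+_ (cong sum (sym (map-∘ ys))) (∑-cartesianProductWith h g xs ys) ⟩
    ∑ ys (λ v → g (h u v)) + ∑ xs (λ u → ∑ ys (λ v → g (h u v))) ∎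
    where
    open ≡-Reasoning
    rest = cartesianProductWith h xs ys

∑-allFin-suc : ∀ n (g : Fin (suc n) → ℕ) →
               ∑ (allFin (suc n)) g ≡ g zero + ∑ (allFin n) (g ∘ suc)
∑-allFin-suc n g = cong (g zero +_) (cong sum
  (trans (map-tabulate suc g) (sym (map-tabulate id (g ∘ suc)))))

-- Sums over assignments

length-cartesianProductWith :
  ∀ {x y z} {X : Set x} {Y : Set y} {Z : Set z} (h : X → Y → Z) xs ys →
  List.length (cartesianProductWith h xs ys) ≡ List.length xs * List.length ys
length-cartesianProductWith h []       ys = refl
length-cartesianProductWith h (x ∷ xs) ys = trans (length-++ (map (h x) ys))
  (cong₂ _+_ (length-map (h x) ys) (length-cartesianProductWith h xs ys))

length-assignments : ∀ n r → List.length (assignments n r) ≡ r ^ n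
length-assignments zero    r = refl
length-assignments (suc n) r =
  trans (length-cartesianProductWith _∷_ (allFin r) (assignments n r))
    (cong₂ _*_ (length-tabulate {n = r} id) (length-assignments n r))

-- The maxima are taken along the lexicographic order of the strings, not along the coordinates of
-- `π`. So the first value of that sequence, at an arbitrary position `i`, has to be summed out
-- separately.
∑-insertAt : ∀ {n r} (i : Fin (suc n)) (F : Vec (Fin r) (suc n) → ℕ) →
  ∑ (assignments (suc n) r) F ≡
  ∑ (allFin r) (λ v → ∑ (assignments n r) (λ π → F (insertAt π i v)))
∑-insertAt {n} {r} zero F = ∑-cartesianProductWith _∷_ F (allFin r) (assignments n r)
∑-insertAt {suc n} {r} (suc i) F = begin
  ∑ (assignments (2 + n) r) F
    ≡⟨ ∑-insertAt zero F ⟩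
  ∑ (allFin r) (λ v → ∑ (assignments (suc n) r) (λ π → F (v ∷ π)))
    ≡⟨ ∑-cong (allFin r) (λ v → ∑-insertAt i (F ∘ (v ∷_))) ⟩
  ∑ (allFin r) (λ v → ∑ (allFin r) λ w → ∑ (assignments n r) (λ π → F (v ∷ insertAt π i w)))
    ≡⟨ ∑-swap (λ v w → ∑ (assignments n r) (λ π → F (v ∷ insertAt π i w))) (allFin r) (allFin r) ⟩
  ∑ (allFin r) (λ w → ∑ (allFin r) λ v → ∑ (assignments n r) (λ π → F (v ∷ insertAt π i w)))
    ≡⟨ ∑-cong (allFin r) (λ w → sym (∑-insertAt {n} zero (λ π → F (insertAt π (suc i) w)))) ⟩
  ∑ (allFin r) (λ w → ∑ (assignments (suc n) r) (λ π → F (insertAt π (suc i) w))) ∎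
  where open ≡-Reasoning

-- Weak left-to-right maxima and the expectation of 2 to their number

-- Maxima are weak because a trie may put either of two nodes of equal
-- priority above the other.

records : ∀ {i} {I : Set i} → (I → ℕ) → ℕ → List I → ℕ
records f θ []       = 0
records f θ (x ∷ xs) =
  if f x <ᵇ θ then records f θ xs else suc (records f (f x) xs)

ranks : ∀ {n r} → Vec (Fin r) n → Fin n → ℕ
ranks π = toℕ ∘ lookup π

records-map : ∀ {i j} {I : Set i} {J : Set j} (h : J → I) {f : I → ℕ} {g : J → ℕ} →
              (∀ j → f (h j) ≡ g j) → ∀ θ js → records f θ (map h js) ≡ records g θ js
records-map h eq θ []       = refl
records-map h {f} {g} eq θ (j ∷ js)
  rewrite eq j | records-map h {f} {g} eq θ js | records-map h {f} {g} eq (g j) js = refl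

-- As `i` does not recur, all later indices survive the removal of coordinate `i`. Induction on the
-- sequence thereby becomes induction on the dimension as well.
map-punchIn : ∀ {n} (i : Fin (suc n)) {is} → Unique (i ∷ is) →
              ∃[ js ] Unique js × is ≡ map (punchIn i) js
map-punchIn i ([] ∷ []) = [] , [] , refl
map-punchIn i {k ∷ is} ((i≢k ∷ i≢is) ∷ (k∉is ∷ is!))
  with js , js! , refl ← map-punchIn i (i≢is ∷ is!)
  = punchOut i≢k ∷ js , Unique.map⁻ (subst (λ k → Unique (k ∷ map (punchIn i) js))
      (sym (punchIn-punchOut i≢k)) (k∉is ∷ is!))
  , cong (_∷ map (punchIn i) js) (sym (punchIn-punchOut i≢k))

-- The coefficients of the constant and the linear term of the bound for the
-- remaining sequence, when the first value v is summed out.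

factor rise : ℕ → ℕ → ℕ
factor t v = if v <ᵇ t then 1 else 2
rise t v = if v <ᵇ t then t else 2 * v

∑-factor : ∀ {t r} → t ≤ r → ∑ (allFin r) (factor t ∘ toℕ) + t ≡ 2 * r
∑-factor {r = r} z≤n = trans (+-identityʳ _) (trans (∑-const 2 (allFin r))
  (trans (cong (_* 2) (length-tabulate {n = r} id)) (*-comm r 2)))
∑-factor {suc t} {suc r} (s≤s t≤r) = begin
  ∑ (allFin (suc r)) (factor (suc t) ∘ toℕ) + suc t
    ≡⟨ cong (_+ suc t) (∑-allFin-suc r (factor (suc t) ∘ toℕ)) ⟩
  suc (∑ (allFin r) (factor t ∘ toℕ)) + suc t ≡⟨ +-suc _ t ⟩
  2 + (∑ (allFin r) (factor t ∘ toℕ) + t)     ≡⟨ cong (2 +_) (∑-factor t≤r) ⟩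
  2 + 2 * r                                   ≡⟨ *-suc 2 r ⟨
  2 * suc r                                   ∎
  where open ≡-Reasoning

rise-suc : ∀ t v → rise (suc t) (suc v) ≡ rise t v + factor t v
rise-suc t v with v <ᵇ t
... | true  = +-comm 1 t
... | false = trans (*-suc 2 v) (+-comm 2 (2 * v))

-- Discrete form of t² + 2 ∫ᵗʳ v dv = r². The left Riemann sum falls short by r - t.
∑-rise : ∀ {t r} → t ≤ r → ∑ (allFin r) (rise t ∘ toℕ) + r ≡ r * r + t
∑-rise {r = zero} z≤n = refl
∑-rise {r = suc r} z≤n = begin
  ∑ (allFin (suc r)) (rise 0 ∘ toℕ) + suc r
    ≡⟨ cong (_+ suc r) (∑-allFin-suc r (rise 0 ∘ toℕ)) ⟩
  ∑ (allFin r) (λ v → 2 * suc (toℕ v)) + suc r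
    ≡⟨ cong (_+ suc r) (∑-cong (allFin r) (λ v → trans (*-suc 2 (toℕ v)) (+-comm 2 _))) ⟩
  ∑ (allFin r) (λ v → rise 0 (toℕ v) + factor 0 (toℕ v)) + suc r
    ≡⟨ cong (_+ suc r) (∑-+ (rise 0 ∘ toℕ) (factor 0 ∘ toℕ) (allFin r)) ⟩
  W + B + suc r ≡⟨ regroup W B r ⟩
  (W + r) + (B + 0) + 1 ≡⟨ cong₂ (λ p q → p + q + 1) (∑-rise {r = r} z≤n) (∑-factor {r = r} z≤n) ⟩
  r * r + 0 + 2 * r + 1 ≡⟨ square r ⟩
  suc r * suc r + 0 ∎
  where
  open ≡-Reasoning
  W = ∑ (allFin r) (rise 0 ∘ toℕ)
  B = ∑ (allFin r) (factor 0 ∘ toℕ)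
  regroup : ∀ W B r → W + B + suc r ≡ (W + r) + (B + 0) + 1
  regroup = solve-∀
  square : ∀ r → r * r + 0 + 2 * r + 1 ≡ suc r * suc r + 0
  square = solve-∀
∑-rise {suc t} {suc r} (s≤s t≤r) = begin
  ∑ (allFin (suc r)) (rise (suc t) ∘ toℕ) + suc r
    ≡⟨ cong (_+ suc r) (∑-allFin-suc r (rise (suc t) ∘ toℕ)) ⟩
  suc t + ∑ (allFin r) (λ v → rise (suc t) (suc (toℕ v))) + suc r
    ≡⟨ cong (λ x → suc t + x + suc r) (trans (∑-cong (allFin r) (rise-suc t ∘ toℕ))
         (∑-+ (rise t ∘ toℕ) (factor t ∘ toℕ) (allFin r))) ⟩
  suc t + (W + B) + suc r ≡⟨ regroup W B t r ⟩
  (W + r) + (B + t) + 2   ≡⟨ cong₂ (λ p q → p + q + 2) (∑-rise t≤r) (∑-factor t≤r) ⟩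
  r * r + t + 2 * r + 2   ≡⟨ square r t ⟩
  suc r * suc r + suc t   ∎
  where
  open ≡-Reasoning
  W = ∑ (allFin r) (rise t ∘ toℕ)
  B = ∑ (allFin r) (factor t ∘ toℕ)
  regroup : ∀ W B t r → suc t + (W + B) + suc r ≡ (W + r) + (B + t) + 2
  regroup = solve-∀
  square : ∀ r t → r * r + t + 2 * r + 2 ≡ suc r * suc r + suc t
  square = solve-∀

-- In closed form 2^m - m - 1. The doubling is the factor 2 contributed by a new maximum, and the
-- summand `m` stems from the rounding error in `∑-rise`.
slack : ℕ → ℕ
slack zero    = 0
slack (suc m) = 2 * slack m + m

slack-mono : ∀ {m n} → m ≤ n → slack m ≤ slack n
slack-mono z≤n       = z≤n
slack-mono (s≤s m≤n) = +-mono-≤ (*-monoʳ-≤ 2 (slack-mono m≤n)) m≤n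

module _ (r : ℕ) where

  𝔼 : ∀ {n} → ℕ → List (Fin n) → ℕ
  𝔼 {n} t is = ∑ (assignments n r) (λ π → 2 ^ records (ranks π) t is)

  𝔼-∷ : ∀ {n} i (js : List (Fin n)) t →
        𝔼 t (i ∷ map (punchIn i) js) ≡
        ∑ (allFin r) (λ v → if toℕ v <ᵇ t then 𝔼 t js else 2 * 𝔼 (toℕ v) js)
  𝔼-∷ {n} i js t = trans
    (∑-insertAt {r = r} i (λ π → 2 ^ records (ranks π) t (i ∷ map (punchIn i) js)))
    (∑-cong (allFin r) step)
    where
    shift : ∀ π v θ → records (ranks (insertAt π i v)) θ (map (punchIn i) js) ≡ records (ranks π) θ js
    shift π v = λ θ → records-map (punchIn i) (λ j → cong toℕ (insertAt-punchIn π i v j)) θ js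
    step : ∀ v →
      ∑ (assignments n r) (λ π → 2 ^ records (ranks (insertAt π i v)) t (i ∷ map (punchIn i) js)) ≡
      (if toℕ v <ᵇ t then 𝔼 t js else 2 * 𝔼 (toℕ v) js)
    step v with toℕ v <ᵇ t in eq
    ... | true  = ∑-cong (assignments n r) head
      where
      head : ∀ π → 2 ^ records (ranks (insertAt π i v)) t (i ∷ map (punchIn i) js) ≡
                   2 ^ records (ranks π) t js
      head π rewrite insertAt-lookup π i v | eq = cong (2 ^_) (shift π v t)
    ... | false = trans (∑-cong (assignments n r) head)
                        (∑-* 2 (λ π → 2 ^ records (ranks π) (toℕ v) js) (assignments n r))
      where
      head : ∀ π → 2 ^ records (ranks (insertAt π i v)) t (i ∷ map (punchIn i) js) ≡
                   2 * 2 ^ records (ranks π) (toℕ v) js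
      head π rewrite insertAt-lookup π i v | eq = cong (λ k → 2 * 2 ^ k) (shift π v (toℕ v))

  -- With thresholds rescaled to [0,1], the normalised sum g m t for m
  -- continuous priorities satisfies g (m + 1) t = t (g m t) + 2 ∫ᵗ¹ g m.
  -- The solution is g m t = m + 1 - m t.  The slack pays for ties.

  𝔼-bound : ∀ {n} {is : List (Fin n)} → Unique is → ∀ {t} → t ≤ r →
    let m = List.length is in
    r * 𝔼 t is + m * r ^ n * t ≤ r ^ n * (suc m * r + slack m)
  𝔼-bound {n} [] {t} t≤r = ≤-reflexive (begin
    r * ∑ (assignments n r) (λ _ → 1) + 0 ≡⟨ +-identityʳ _ ⟩
    r * ∑ (assignments n r) (λ _ → 1)
      ≡⟨ cong (r *_) (trans (∑-const 1 (assignments n r)) (trans (*-identityʳ _) (length-assignments n r))) ⟩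
    r * r ^ n                            ≡⟨ *-comm r (r ^ n) ⟩
    r ^ n * r                            ≡⟨ cong (r ^ n *_) (trans (+-identityʳ _) (+-identityʳ r)) ⟨
    r ^ n * (1 * r + 0) ∎)
    where open ≡-Reasoning
  𝔼-bound {suc n} {i ∷ is} is! {t} t≤r
    with js , js! , refl ← map-punchIn i is! = finish
    where
    open ≤-Reasoning
    m = List.length js
    ρ = r ^ n
    c = m * ρ
    B = ρ * (suc m * r + slack m)
    h : ℕ → ℕ
    h v = if v <ᵇ t then 𝔼 t js else 2 * 𝔼 v js
    E = ∑ (allFin r) (h ∘ toℕ)
    double : ∀ r e c v → r * (2 * e) + c * (2 * v) ≡ (r * e + c * v) * 2
    double = solve-∀
    pointwise : ∀ v → v ≤ r → r * h v + c * rise t v ≤ B * factor t v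
    pointwise v v≤r with v <ᵇ t
    ... | true  = ≤-trans (𝔼-bound js! t≤r) (≤-reflexive (sym (*-identityʳ B)))
    ... | false = ≤-trans (≤-reflexive (double r (𝔼 v js) c v)) (*-monoˡ-≤ 2 (𝔼-bound js! v≤r))
    summed : r * E + c * ∑ (allFin r) (rise t ∘ toℕ) ≤ B * ∑ (allFin r) (factor t ∘ toℕ)
    summed = begin
      r * E + c * ∑ (allFin r) (rise t ∘ toℕ)
        ≡⟨ cong₂ _+_ (∑-* r (h ∘ toℕ) (allFin r)) (∑-* c (rise t ∘ toℕ) (allFin r)) ⟨
      ∑ (allFin r) (λ v → r * h (toℕ v)) + ∑ (allFin r) (λ v → c * rise t (toℕ v))
        ≡⟨ ∑-+ (λ v → r * h (toℕ v)) (λ v → c * rise t (toℕ v)) (allFin r) ⟨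
      ∑ (allFin r) (λ v → r * h (toℕ v) + c * rise t (toℕ v))
        ≤⟨ ∑-mono (allFin r) (λ v → pointwise (toℕ v) (<⇒≤ (toℕ<n v))) ⟩
      ∑ (allFin r) (λ v → B * factor t (toℕ v)) ≡⟨ ∑-* B (factor t ∘ toℕ) (allFin r) ⟩
      B * ∑ (allFin r) (factor t ∘ toℕ) ∎
    -- The closed forms are known only for the sums increased by `r` and `t`, so `c * r` and `B * t`
    -- are added on both sides instead of subtracting.
    added : r * E + c * (r * r + t) + B * t ≤ B * (2 * r) + c * r
    added = begin
      r * E + c * (r * r + t) + B * t     ≡⟨ cong (λ x → r * E + c * x + B * t) (∑-rise t≤r) ⟨
      r * E + c * (∑w + r) + B * t        ≡⟨ regroup (r * E) c ∑w r (B * t) ⟩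
      (r * E + c * ∑w) + (B * t + c * r)  ≤⟨ +-monoˡ-≤ _ summed ⟩
      B * ∑b + (B * t + c * r)            ≡⟨ regroup′ B ∑b t (c * r) ⟩
      B * (∑b + t) + c * r                ≡⟨ cong (λ x → B * x + c * r) (∑-factor t≤r) ⟩
      B * (2 * r) + c * r ∎
      where
      ∑w = ∑ (allFin r) (rise t ∘ toℕ)
      ∑b = ∑ (allFin r) (factor t ∘ toℕ)
      regroup : ∀ x c y r z → x + c * (y + r) + z ≡ (x + c * y) + (z + c * r)
      regroup = solve-∀
      regroup′ : ∀ B y t z → B * y + (B * t + z) ≡ B * (y + t) + z
      regroup′ = solve-∀
    expand : ∀ x ρ m r t s →
      x + suc m * (r * ρ) * t + (m * ρ * (r * r) + m * ρ * t + ρ * s * t) ≡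
      x + m * ρ * (r * r + t) + ρ * (suc m * r + s) * t
    expand = solve-∀
    expand′ : ∀ ρ m r s →
      ρ * (suc m * r + s) * (2 * r) + m * ρ * r ≡
      r * ρ * (suc (suc m) * r + (2 * s + m)) + m * ρ * (r * r)
    expand′ = solve-∀
    finish : let m′ = List.length (map (punchIn i) js) in
             r * 𝔼 t (i ∷ map (punchIn i) js) + suc m′ * r ^ suc n * t ≤
             r ^ suc n * (suc (suc m′) * r + slack (suc m′))
    -- 2 (m + 1) = (m + 2) + m: doubling overshoots the constant term by `c * (r * r)`, and exactly
    -- this is gained from the term linear in the threshold.
    finish rewrite length-map (punchIn i) js | 𝔼-∷ i js t = +-cancelʳ-≤ (c * (r * r)) _ _ (begin
      r * E + suc m * (r * ρ) * t + c * (r * r)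
        ≤⟨ +-monoʳ-≤ (r * E + suc m * (r * ρ) * t)
             (≤-trans (m≤m+n (c * (r * r)) (c * t)) (m≤m+n _ (ρ * slack m * t))) ⟩
      r * E + suc m * (r * ρ) * t + (c * (r * r) + c * t + ρ * slack m * t)
        ≡⟨ expand (r * E) ρ m r t (slack m) ⟩
      r * E + c * (r * r + t) + B * t ≤⟨ added ⟩
      B * (2 * r) + c * r             ≡⟨ expand′ ρ m r (slack m) ⟩
      r * ρ * (suc (suc m) * r + (2 * slack m + m)) + c * (r * r) ∎)

  -- Once `slack n ≤ r`, ties add at most one to the value n + 1 for continuous priorities.
  𝔼-bound₀ : ∀ {n} {is : List (Fin n)} → Unique is → List.length is ≤ n → 1 ≤ r → slack n ≤ r →
             𝔼 0 is ≤ r ^ n * (2 + n)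
  𝔼-bound₀ {n} {is} is! m≤n 1≤r s≤r = *-cancelˡ-≤ r (begin
    r * 𝔼 0 is                               ≤⟨ m≤m+n _ (m * r ^ n * 0) ⟩
    r * 𝔼 0 is + m * r ^ n * 0               ≤⟨ 𝔼-bound is! z≤n ⟩
    r ^ n * (suc m * r + slack m)
      ≤⟨ *-monoʳ-≤ (r ^ n) (+-mono-≤ (*-monoˡ-≤ r (s≤s m≤n)) (≤-trans (slack-mono m≤n) s≤r)) ⟩
    r ^ n * (suc n * r + r)                  ≡⟨ regroup (r ^ n) n r ⟩
    r * (r ^ n * (2 + n))                    ∎)
    where
    open ≤-Reasoning
    instance _ = >-nonZero 1≤r
    m = List.length is
    regroup : ∀ ρ n r → ρ * (suc n * r + r) ≡ r * (ρ * (2 + n))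
    regroup = solve-∀

-- Maxima of initial segments

module _ {i} {I : Set i} (f : I → ℕ) where

  records-pos : ∀ {θ k xs} → k ∈ xs → θ ≤ f k → 1 ≤ records f θ xs
  records-pos {θ} {k} {x ∷ xs} k∈ θ≤ with f x <ᵇ θ in eq | k∈
  ... | false | _         = s≤s z≤n
  ... | true  | there k∈′ = records-pos k∈′ θ≤
  ... | true  | here refl = contradiction (<ᵇ⇒< (f x) θ (subst T (sym eq) _)) (≤⇒≯ θ≤)

  module _ {p q} {P : Pred I p} {Q : Pred I q} (P? : Decidable P) (Q? : Decidable Q)
           (P⊆Q : ∀ {j} → P j → Q j) where

    -- This makes `filter P? xs` an initial segment of `filter Q? xs`, so that the running maxima of
    -- both agree on the common part.
    Initial : List I → Set (i ⊔ p ⊔ q)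
    Initial = AllPairs (λ j k → Q j → ¬ P j → ¬ P k)

    records-⊆ : ∀ {xs} → Initial xs → ∀ θ →
                records f θ (filter P? xs) ≤ records f θ (filter Q? xs)
    records-⊆ [] θ = z≤n
    records-⊆ {x ∷ xs} (x≺xs ∷ ini) θ with P? x | Q? x
    ... | no  _ | no  _ = records-⊆ ini θ
    ... | yes p | no ¬q = contradiction (P⊆Q p) ¬q
    ... | no ¬p | yes q rewrite filter-none P? (All.map (λ h → h q ¬p) x≺xs) = z≤n
    ... | yes p | yes q with f x <ᵇ θ
    ...   | true  = records-⊆ ini θ
    ...   | false = s≤s (records-⊆ ini (f x))

    -- After the common initial segment the running maximum is still at most `f k`, so a further
    -- maximum occurs at `k` or before it.
    records-⊂ : ∀ {xs} → Initial xs → ∀ {θ k} → k ∈ xs → Q k → ¬ P k → θ ≤ f k →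
                (∀ {j} → P j → f j ≤ f k) →
                records f θ (filter P? xs) < records f θ (filter Q? xs)
    records-⊂ {x ∷ xs} (x≺xs ∷ ini) {θ} {k} k∈ qk ¬pk θ≤ max with P? x | Q? x
    records-⊂ (_ ∷ ini) (here refl) qk ¬pk θ≤ max | no _ | no ¬q = contradiction qk ¬q
    records-⊂ (_ ∷ ini) (there k∈) qk ¬pk θ≤ max | no _ | no _ =
      records-⊂ ini k∈ qk ¬pk θ≤ max
    ... | yes p | no ¬q = contradiction (P⊆Q p) ¬q
    ... | no ¬p | yes q rewrite filter-none P? (All.map (λ h → h q ¬p) x≺xs) =
      records-pos (subst (k ∈_) (filter-accept Q? q) (∈-filter⁺ Q? k∈ qk)) θ≤
    records-⊂ (_ ∷ ini) (here refl) qk ¬pk θ≤ max | yes p | yes q = contradiction p ¬pk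
    records-⊂ {x ∷ xs} (_ ∷ ini) {θ} (there k∈) qk ¬pk θ≤ max | yes p | yes q with f x <ᵇ θ
    ... | true  = records-⊂ ini k∈ qk ¬pk θ≤ max
    ... | false = s≤s (records-⊂ ini k∈ qk ¬pk (max p) max)

<ᵇ-true : ∀ m n → (m <ᵇ n) ≡ true → m < n
<ᵇ-true m n eq = <ᵇ⇒< m n (subst T (sym eq) _)

<ᵇ-false : ∀ m n → (m <ᵇ n) ≡ false → n ≤ m
<ᵇ-false m n eq = ≮⇒≥ λ m<n → subst T eq (<⇒<ᵇ m<n)

-- Divergence to the right, and the subtrees of an r-trie

module Right {a ℓ} {A : Set a} {_≺_ : Rel A ℓ} (sto : IsStrictTotalOrder _≡_ _≺_) where

  open IsStrictTotalOrder sto using (compare)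
    renaming (irrefl to ≺-irrefl; trans to ≺-trans; asym to ≺-asym)
  open RTrie sto

  -- Unlike in the lexicographic order, a proper prefix is not smaller.

  data _⋖_ : Rel (List A) (a ⊔ ℓ) where
    this : ∀ {c e cs es} → c ≺ e → (c ∷ cs) ⋖ (e ∷ es)
    next : ∀ {c cs es} → cs ⋖ es → (c ∷ cs) ⋖ (c ∷ es)

  _⋖?_ : ∀ cs es → Dec (cs ⋖ es)
  []       ⋖? es       = no λ ()
  (c ∷ cs) ⋖? []       = no λ ()
  (c ∷ cs) ⋖? (e ∷ es) with compare c e
  ... | tri< c≺e _ _    = yes (this c≺e)
  ... | tri> c⊀e c≢e _  = no λ { (this c≺e) → c⊀e c≺e ; (next _) → c≢e refl }
  ... | tri≈ c⊀e refl _ = map′ next (λ { (this c≺c) → contradiction c≺c c⊀e ; (next h) → h }) (cs ⋖? es)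

  NonEmpty : List A → Set a
  NonEmpty u = ∃[ e ] ∃[ es ] u ≡ e ∷ es

  nonEmpty? : ∀ u → Dec (NonEmpty u)
  nonEmpty? []       = no λ ()
  nonEmpty? (e ∷ es) = yes (e , es , refl)

  -- The parts of a family of strings that belong to the three subtrees of a
  -- node with character d.  The empty string stands for absence.

  below under above : A → List A → List A
  below d [] = []
  below d (e ∷ es) with compare e d
  ... | tri< _ _ _ = e ∷ es
  ... | tri≈ _ _ _ = []
  ... | tri> _ _ _ = []
  under d [] = []
  under d (e ∷ es) with compare e d
  ... | tri< _ _ _ = []
  ... | tri≈ _ _ _ = es
  ... | tri> _ _ _ = []
  above d [] = []
  above d (e ∷ es) with compare e d
  ... | tri< _ _ _ = []
  ... | tri≈ _ _ _ = []
  ... | tri> _ _ _ = e ∷ es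

  below⁻ : ∀ {d e es} u → below d u ≡ e ∷ es → u ≡ e ∷ es × e ≺ d
  below⁻ {d} (x ∷ xs) eq with compare x d
  below⁻ (x ∷ xs) refl | tri< x≺d _ _ = refl , x≺d

  below⁺ : ∀ {d e es} → e ≺ d → below d (e ∷ es) ≡ e ∷ es
  below⁺ {d} {e} e≺d with compare e d
  ... | tri< _ _ _   = refl
  ... | tri≈ e⊀d _ _ = contradiction e≺d e⊀d
  ... | tri> e⊀d _ _ = contradiction e≺d e⊀d

  above⁻ : ∀ {d e es} u → above d u ≡ e ∷ es → u ≡ e ∷ es × d ≺ e
  above⁻ {d} (x ∷ xs) eq with compare x d
  above⁻ (x ∷ xs) refl | tri> _ _ d≺x = refl , d≺x

  above⁺ : ∀ {d e es} → d ≺ e → above d (e ∷ es) ≡ e ∷ es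
  above⁺ {d} {e} d≺e with compare e d
  ... | tri> _ _ _   = refl
  ... | tri≈ _ _ d⊁e = contradiction d≺e d⊁e
  ... | tri< _ _ d⊁e = contradiction d≺e d⊁e

  under⁻ : ∀ {d e es} u → under d u ≡ e ∷ es → u ≡ d ∷ e ∷ es
  under⁻ {d} (x ∷ xs) eq with compare x d
  under⁻ (x ∷ xs) refl | tri≈ _ refl _ = refl

  under⁺ : ∀ {d es} → under d (d ∷ es) ≡ es
  under⁺ {d} with compare d d
  ... | tri≈ _ _ _   = refl
  ... | tri< d≺d _ _ = contradiction d≺d (≺-irrefl refl)
  ... | tri> _ _ d≺d = contradiction d≺d (≺-irrefl refl)

  _⊑_ : List⁺ A → List A → Set a
  w ⊑ u = Prefix _≡_ (toList w) u

  ⊑-head : ∀ {w u} → w ⊑ u → ∃[ es ] u ≡ List⁺.head w ∷ es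
  ⊑-head (refl ∷ _) = _ , refl

  ⊑-below⁻ : ∀ {w d} u → w ⊑ below d u → w ⊑ u × List⁺.head w ≺ d
  ⊑-below⁻ {d = d} (e ∷ es) w⊑ with compare e d
  ⊑-below⁻ (e ∷ es) (refl ∷ w⊑) | tri< e≺d _ _ = refl ∷ w⊑ , e≺d

  ⊑-below⁺ : ∀ {w d u} → w ⊑ u → List⁺.head w ≺ d → w ⊑ below d u
  ⊑-below⁺ (refl ∷ w⊑) w≺d = subst (Prefix _≡_ _) (sym (below⁺ w≺d)) (refl ∷ w⊑)

  ⊑-above⁻ : ∀ {w d} u → w ⊑ above d u → w ⊑ u × d ≺ List⁺.head w
  ⊑-above⁻ {d = d} (e ∷ es) w⊑ with compare e d
  ⊑-above⁻ (e ∷ es) (refl ∷ w⊑) | tri> _ _ d≺e = refl ∷ w⊑ , d≺e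

  ⊑-above⁺ : ∀ {w d u} → w ⊑ u → d ≺ List⁺.head w → w ⊑ above d u
  ⊑-above⁺ (refl ∷ w⊑) d≺w = subst (Prefix _≡_ _) (sym (above⁺ d≺w)) (refl ∷ w⊑)

  ⊑-under⁻ : ∀ {w d} u → w ⊑ under d u → (d ∷⁺ w) ⊑ u
  ⊑-under⁻ {d = d} (e ∷ es) w⊑ with compare e d
  ... | tri≈ _ refl _ = refl ∷ w⊑

  ⊑-under⁺ : ∀ {w d u} → (d ∷⁺ w) ⊑ u → w ⊑ under d u
  ⊑-under⁺ {d = d} (refl ∷ w⊑) = subst (Prefix _≡_ _) (sym under⁺) w⊑

  module _ {n} (f : Fin n → ℕ) where

    -- IsRTrie in a form that is inherited by all three subtrees; priorities
    -- are shifted by one as in priority.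

    record Represents (U : Fin n → List A) (t : Trie) : Set (a ⊔ ℓ) where
      field
        ordered  : ∀ {w d p sp l m r} → t ∋ w ↦ node d p sp l m r →
                   AllSiblings (λ e → e ≺ d) l × AllSiblings (λ e → d ≺ e) r
        complete : ∀ {w} i → w ⊑ U i → ∃ λ x → t ∋ w ↦ x
        upper    : ∀ {w d p sp l m r} → t ∋ w ↦ node d p sp l m r →
                   ∀ i → w ⊑ U i → suc (f i) ≤ p
        attained : ∀ {w d p sp l m r} → t ∋ w ↦ node d p sp l m r →
                   ∃ λ i → w ⊑ U i × p ≡ suc (f i)
        heap     : ∀ {w d p sp l m r} → t ∋ w ↦ node d p sp l m r →
                   prio l ≤ p × prio r ≤ p

    siblings-∋ : ∀ {p} {P : Pred A p} {t w x} → AllSiblings P t → t ∋ w ↦ x → P (List⁺.head w)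
    siblings-∋ (node pd _ _) here      = pd
    siblings-∋ (node pd _ _) (mid _)   = pd
    siblings-∋ (node _ pl _) (left h)  = siblings-∋ pl h
    siblings-∋ (node _ _ pr) (right h) = siblings-∋ pr h

    module _ {U : Fin n → List A} {d p sp l m r} (rep : Represents U (node d p sp l m r)) where

      open Represents rep

      private
        head-l : ∀ {w x} → l ∋ w ↦ x → List⁺.head w ≺ d
        head-l = siblings-∋ (proj₁ (ordered here))

        head-r : ∀ {w x} → r ∋ w ↦ x → d ≺ List⁺.head w
        head-r = siblings-∋ (proj₂ (ordered here))

      represents-below : Represents (below d ∘ U) l
      represents-below = record
        { ordered  = ordered ∘ left
        ; complete = λ i w⊑ → let w⊑u , w≺d = ⊑-below⁻ (U i) w⊑ in inl w≺d (complete i w⊑u)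
        ; upper    = λ h i w⊑ → upper (left h) i (proj₁ (⊑-below⁻ (U i) w⊑))
        ; attained = λ h → let i , w⊑ , eq = attained (left h) in i , ⊑-below⁺ w⊑ (head-l h) , eq
        ; heap     = heap ∘ left
        }
        where
        inl : ∀ {w} → List⁺.head w ≺ d → ∃ (node d p sp l m r ∋ w ↦_) → ∃ (l ∋ w ↦_)
        inl w≺d (_ , here)    = contradiction w≺d (≺-irrefl refl)
        inl w≺d (_ , mid h)   = contradiction w≺d (≺-irrefl refl)
        inl w≺d (x , left h)  = x , h
        inl w≺d (_ , right h) = contradiction w≺d (≺-asym (head-r h))

      represents-above : Represents (above d ∘ U) r
      represents-above = record
        { ordered  = ordered ∘ right
        ; complete = λ i w⊑ → let w⊑u , d≺w = ⊑-above⁻ (U i) w⊑ in inr d≺w (complete i w⊑u)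
        ; upper    = λ h i w⊑ → upper (right h) i (proj₁ (⊑-above⁻ (U i) w⊑))
        ; attained = λ h → let i , w⊑ , eq = attained (right h) in i , ⊑-above⁺ w⊑ (head-r h) , eq
        ; heap     = heap ∘ right
        }
        where
        inr : ∀ {w} → d ≺ List⁺.head w → ∃ (node d p sp l m r ∋ w ↦_) → ∃ (r ∋ w ↦_)
        inr d≺w (_ , here)    = contradiction d≺w (≺-irrefl refl)
        inr d≺w (_ , mid h)   = contradiction d≺w (≺-irrefl refl)
        inr d≺w (x , right h) = x , h
        inr d≺w (_ , left h)  = contradiction d≺w (≺-asym (head-l h))

      represents-under : Represents (under d ∘ U) m
      represents-under = record
        { ordered  = ordered ∘ mid
        ; complete = λ i w⊑ → inm (complete i (⊑-under⁻ (U i) w⊑))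
        ; upper    = λ h i w⊑ → upper (mid h) i (⊑-under⁻ (U i) w⊑)
        ; attained = λ h → let i , w⊑ , eq = attained (mid h) in i , ⊑-under⁺ w⊑ , eq
        ; heap     = heap ∘ mid
        }
        where
        inm : ∀ {w} → ∃ (node d p sp l m r ∋ d ∷⁺ w ↦_) → ∃ (m ∋ w ↦_)
        inm (x , mid h)   = x , h
        inm (_ , left h)  = contradiction (head-l h) (≺-irrefl refl)
        inm (_ , right h) = contradiction (head-r h) (≺-irrefl refl)

    -- The first character of the string has a node among the siblings of the root. That node has at
    -- least the priority of the string, and the heap order carries this up to the root.
    prio-upper : ∀ {U t i} → Represents U t → NonEmpty (U i) → suc (f i) ≤ prio t
    prio-upper {U} {t} {i} rep (e , es , eq) with Represents.complete rep {w = e ∷ []} i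
        (subst (Prefix _≡_ _) (sym eq) (refl ∷ []))
    ... | x , h = ≤-trans (at-node h) (to-root (Represents.heap rep) h)
      where
      at-node : ∀ {x} → t ∋ e ∷ [] ↦ x → suc (f i) ≤ prio x
      at-node {nil}              h = contradiction h λ h → not-nil h
        where
        not-nil : ∀ {t w} → ¬ t ∋ w ↦ nil
        not-nil (left h)  = not-nil h
        not-nil (mid h)   = not-nil h
        not-nil (right h) = not-nil h
      at-node {node _ _ _ _ _ _} h = Represents.upper rep h i
        (subst (Prefix _≡_ _) (sym eq) (refl ∷ []))
      to-root : ∀ {t x} → (∀ {w d p sp l m r} → t ∋ w ↦ node d p sp l m r → prio l ≤ p × prio r ≤ p) →
                t ∋ e ∷ [] ↦ x → prio x ≤ prio t
      to-root heap here      = ≤-refl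
      to-root heap (left h)  = ≤-trans (to-root (heap ∘ left) h) (proj₁ (heap here))
      to-root heap (right h) = ≤-trans (to-root (heap ∘ right) h) (proj₂ (heap here))

  -- Turns and sinking steps on one side of the search path

  -- Only the nodes to the right of the search path are counted here and in
  -- sinks; those to the left are on the right in the mirrored trie.

  turns : Trie → A → List A → ℕ
  turns nil                c cs = 0
  turns (node d p sp l m r) c cs with compare c d
  ... | tri< _ _ _ = suc (turns l c cs)
  ... | tri> _ _ _ = turns r c cs
  turns (node d p sp l m r) c []        | tri≈ _ _ _ = 0
  turns (node d p sp l m r) c (c′ ∷ cs) | tri≈ _ _ _ = turns m c′ cs

  -- A lower bound for the priority of the root after the deletion of a string.

  rest : Trie → A → List A → ℕ
  rest nil                 c cs = 0
  rest (node d p sp l m r) c cs with compare c d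
  ... | tri< _ _ _ = p
  ... | tri> _ _ _ = p
  rest (node d p sp l m r) c []        | tri≈ _ _ _ = prio l ℕ.⊔ prio r
  rest (node d p sp l m r) c (c′ ∷ cs) | tri≈ _ _ _ = (prio l ℕ.⊔ prio r) ℕ.⊔ rest m c′ cs

  -- The nodes of the right subtree that a node of priority p sinks below.

  spine : Trie → ℕ → ℕ
  spine nil                 p = 0
  spine (node e q sq l m r) p = if p <ᵇ q then suc (spine l p) else 0

  spine-anti : ∀ t {p q} → p ≤ q → spine t q ≤ spine t p
  spine-anti nil p≤q = z≤n
  spine-anti (node e s _ l m r) {p} {q} p≤q with q <ᵇ s in q<s | p <ᵇ s in p<s
  ... | false | _     = z≤n
  ... | true  | true  = s≤s (spine-anti l p≤q)
  ... | true  | false = contradiction (<ᵇ-false p s p<s) (<⇒≱ (≤-<-trans p≤q (<ᵇ-true q s q<s)))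

  sinks : Trie → A → List A → ℕ
  sinks nil                 c cs = 0
  sinks (node d p sp l m r) c cs with compare c d
  ... | tri< _ _ _ = sinks l c cs
  ... | tri> _ _ _ = sinks r c cs
  sinks (node d p sp l m r) c []        | tri≈ _ _ _ = spine r 0
  sinks (node d p sp l m r) c (c′ ∷ cs) | tri≈ _ _ _ = spine r (rest m c′ cs) + sinks m c′ cs

  below-⋖ : ∀ {s d} u → s ⋖ below d u → s ⋖ u × ∃[ e ] ∃[ es ] (u ≡ e ∷ es × e ≺ d)
  below-⋖ {d = d} (e ∷ es) h with compare e d
  below-⋖ (e ∷ es) h | tri< e≺d _ _ = h , e , es , refl , e≺d

  above-⋖ : ∀ {s d} u → s ⋖ above d u → s ⋖ u × ∃[ e ] ∃[ es ] (u ≡ e ∷ es × d ≺ e)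
  above-⋖ {d = d} (e ∷ es) h with compare e d
  above-⋖ (e ∷ es) h | tri> _ _ d≺e = h , e , es , refl , d≺e

  under-⋖ : ∀ {s d} u → s ⋖ under d u → (d ∷ s) ⋖ u × ∃[ es ] (u ≡ d ∷ es)
  under-⋖ {d = d} (e ∷ es) h with compare e d
  under-⋖ (e ∷ es) h | tri≈ _ refl _ = next h , es , refl

  this′ : ∀ {c e cs es u v} → u ≡ c ∷ cs → v ≡ e ∷ es → c ≺ e → u ⋖ v
  this′ refl refl = this

  -- Maxima bound turns and sinking steps

  module _ {n} (f : Fin n → ℕ) (S : Fin n → List A) (L : List (Fin n))
           (all∈ : ∀ i → i ∈ L) (sorted : AllPairs (λ i j → ¬ S j ⋖ S i) L) where

    -- In the descent, the strings of `U` are absent or remainders after a common prefix, so they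
    -- compare as the full strings do. Hence one list `L`, sorted once, serves all subtrees.
    Embeds : (Fin n → List A) → Set (a ⊔ ℓ)
    Embeds U = ∀ {i j} → U i ⋖ U j → S i ⋖ S j

    private
      -- Typically `Q` holds for the strings in view and `P` for those that remain after a step of
      -- the descent. The lost ones lie farther to the right, so sortedness puts the kept ones
      -- first.
      module Step {p q} {P : Pred (Fin n) p} {Q : Pred (Fin n) q} (P? : Decidable P) (Q? : Decidable Q)
               (P⊆Q : ∀ {j} → P j → Q j) (P≺Q : ∀ {i j} → P i → Q j → ¬ P j → S i ⋖ S j) where

        initial : Initial f P? Q? P⊆Q L
        initial = AllPairs.map (λ ¬⋖ q ¬p p → ¬⋖ (P≺Q p q ¬p)) sorted

        count-⊆ : records f 0 (filter P? L) ≤ records f 0 (filter Q? L)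
        count-⊆ = records-⊆ f P? Q? P⊆Q initial 0

        count-⊂ : ∀ k → Q k → ¬ P k → (∀ {j} → P j → f j ≤ f k) →
                  records f 0 (filter P? L) < records f 0 (filter Q? L)
        count-⊂ k qk ¬pk = records-⊂ f P? Q? P⊆Q initial (all∈ k) qk ¬pk z≤n

    count : List A → (Fin n → List A) → ℕ
    count s U = records f 0 (filter (λ i → s ⋖? U i) L)

    embeds-below : ∀ {U d} → Embeds U → Embeds (below d ∘ U)
    embeds-below {U} {d} emb {i} {j} h with below d (U i) in eqi | below d (U j) in eqj
    ... | x ∷ xs | y ∷ ys = emb (subst₂ _⋖_ (sym (proj₁ (below⁻ (U i) eqi))) (sym (proj₁ (below⁻ (U j) eqj))) h)

    embeds-above : ∀ {U d} → Embeds U → Embeds (above d ∘ U)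
    embeds-above {U} {d} emb {i} {j} h with above d (U i) in eqi | above d (U j) in eqj
    ... | x ∷ xs | y ∷ ys = emb (subst₂ _⋖_ (sym (proj₁ (above⁻ (U i) eqi))) (sym (proj₁ (above⁻ (U j) eqj))) h)

    embeds-under : ∀ {U d} → Embeds U → Embeds (under d ∘ U)
    embeds-under {U} {d} emb {i} {j} h with under d (U i) in eqi | under d (U j) in eqj
    ... | x ∷ xs | y ∷ ys = emb (subst₂ _⋖_ (sym (under⁻ (U i) eqi)) (sym (under⁻ (U j) eqj)) (next h))

    private
      nonEmpty : ∀ {s u} → s ⋖ u → NonEmpty u
      nonEmpty (this _) = _ , _ , refl
      nonEmpty (next _) = _ , _ , refl

      ≺-not-below : ∀ {e d u} → e ≺ d → NonEmpty u → ¬ NonEmpty (below d u) →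
                    ∃[ x ] ∃[ xs ] (u ≡ x ∷ xs × e ≺ x)
      ≺-not-below {d = d} e≺d (x , xs , refl) ¬below with compare x d
      ... | tri< _ _ _    = contradiction (x , xs , refl) ¬below
      ... | tri≈ _ refl _ = x , xs , refl , e≺d
      ... | tri> _ _ d≺x  = x , xs , refl , ≺-trans e≺d d≺x

      ⋖-below : ∀ {s d u} → s ⋖ u → NonEmpty (below d u) → s ⋖ below d u
      ⋖-below {d = d} {u} s⋖u (e , es , eq) = subst (_ ⋖_) (trans (proj₁ (below⁻ u eq)) (sym eq)) s⋖u

      nonEmpty-below : ∀ {d} u → NonEmpty (below d u) → NonEmpty u
      nonEmpty-below u (e , es , eq) = e , es , proj₁ (below⁻ u eq)

      ¬head-below : ∀ {d es u} → u ≡ d ∷ es → ¬ NonEmpty (below d u)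
      ¬head-below {u = u} u≡ (e , es , eq) with eq′ , e≺d ← below⁻ u eq with refl ← trans (sym u≡) eq′ =
        ≺-irrefl refl e≺d

      below-≺ : ∀ {U d s i j} → Embeds U → s ⋖ below d (U i) → s ⋖ U j → ¬ s ⋖ below d (U j) → S i ⋖ S j
      below-≺ {U} {i = i} emb i∈ j∈ j∉ =
        let _ , e , es , Ui , e≺d = below-⋖ (U i) i∈
            x , xs , Uj , e≺x = ≺-not-below e≺d (nonEmpty j∈) (j∉ ∘ ⋖-below j∈)
        in emb (this′ Ui Uj e≺x)

      ⋖-under : ∀ {d cs es} → cs ⋖ es → cs ⋖ under d (d ∷ es)
      ⋖-under = subst (_ ⋖_) (sym under⁺)

      ⋖-cases : ∀ {d cs u} → (d ∷ cs) ⋖ u → NonEmpty (above d u) ⊎ cs ⋖ under d u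
      ⋖-cases (this d≺e) = inj₁ (_ , _ , above⁺ d≺e)
      ⋖-cases (next h)   = inj₂ (⋖-under h)

    -- A string to the right of `c ∷ cs` begins with `c` or a larger character, hence above `d`: a
    -- step to the right loses none of them.
    above-step : ∀ {U d c cs} → d ≺ c → count (c ∷ cs) (above d ∘ U) ≤ count (c ∷ cs) U
    above-step {U} {d} {c} {cs} d≺c = Step.count-⊆
      (λ i → (c ∷ cs) ⋖? above d (U i)) (λ i → (c ∷ cs) ⋖? U i)
      (λ {i} → proj₁ ∘ above-⋖ (U i)) (λ {i} {j} _ j∈ j∉ → contradiction (⋖-above j∈) j∉)
      where
      ⋖-above : ∀ {u} → (c ∷ cs) ⋖ u → (c ∷ cs) ⋖ above d u
      ⋖-above (this c≺e) = subst (_ ⋖_) (sym (above⁺ (≺-trans d≺c c≺e))) (this c≺e)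
      ⋖-above (next h)   = subst (_ ⋖_) (sym (above⁺ d≺c)) (next h)

    -- A step down loses the strings that diverge at `d`. Those that diverge later are closer to s.
    under-step : ∀ {U d cs} → Embeds U → count cs (under d ∘ U) ≤ count (d ∷ cs) U
    under-step {U} {d} {cs} emb = Step.count-⊆
      (λ i → cs ⋖? under d (U i)) (λ i → (d ∷ cs) ⋖? U i)
      (λ {i} → proj₁ ∘ under-⋖ (U i))
      (λ {i} {j} i∈ j∈ j∉ → emb (farther (proj₂ (proj₂ (under-⋖ (U i) i∈))) j∈ j∉))
      where
      farther : ∀ {u v es} → u ≡ d ∷ es → (d ∷ cs) ⋖ v → ¬ cs ⋖ under d v → u ⋖ v
      farther refl (this d≺e) _  = this d≺e
      farther refl (next h)   h∉ = contradiction (⋖-under h) h∉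

    below-step : ∀ {U s d} → Embeds U → count s (below d ∘ U) ≤ count s U
    below-step {U} {s} {d} emb = Step.count-⊆
      (λ i → s ⋖? below d (U i)) (λ i → s ⋖? U i)
      (λ {i} → proj₁ ∘ below-⋖ (U i)) (below-≺ emb)

    -- Only a step to the left adds to `turns`. It loses the string `k`, which by the heap order has
    -- at least the priority of every string kept, so `records-⊂` pays for the step.
    turns-bound : ∀ {U c cs} t → Represents f U t → Embeds U → turns t c cs ≤ count (c ∷ cs) U
    turns-bound nil rep emb = z≤n
    turns-bound {U} {c} {cs} (node d p sp l m r) rep emb with compare c d
    ... | tri< c≺d _ _ = ≤-trans
        (s≤s (turns-bound {cs = cs} l (represents-below f rep) (embeds-below emb)))
        (count-⊂ k k∈ (¬head-below Uk ∘ nonEmpty) λ {j} j∈ →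
          s≤s⁻¹ (≤-trans (prio-upper f (represents-below f rep) (nonEmpty j∈))
                  (≤-trans (proj₁ (heap here)) (≤-reflexive p≡))))
      where
      open Represents rep
      k = proj₁ (attained here)
      p≡ : p ≡ suc (f k)
      p≡ = proj₂ (proj₂ (attained here))
      Uk : U k ≡ d ∷ proj₁ (⊑-head (proj₁ (proj₂ (attained here))))
      Uk = proj₂ (⊑-head (proj₁ (proj₂ (attained here))))
      k∈ : (c ∷ cs) ⋖ U k
      k∈ = subst (_ ⋖_) (sym Uk) (this c≺d)
      open Step (λ i → (c ∷ cs) ⋖? below d (U i)) (λ i → (c ∷ cs) ⋖? U i)
        (λ {i} → proj₁ ∘ below-⋖ (U i))
        (below-≺ emb)
    turns-bound {U} {c} {cs} (node d p sp l m r) rep emb | tri> c⊀d _ d≺c = ≤-trans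
      (turns-bound r (represents-above f rep) (embeds-above emb))
      (above-step d≺c)
    turns-bound {cs = []} (node d p sp l m r) rep emb | tri≈ _ _ _ = z≤n
    turns-bound {cs = c′ ∷ cs} (node d p sp l m r) rep emb | tri≈ _ refl _ = ≤-trans
      (turns-bound m (represents-under f rep) (embeds-under emb))
      (under-step emb)

    -- A string to the right of the deleted one stays in the trie, in a sibling subtree or further
    -- down. `level-bound` takes its threshold from here.
    rest-upper : ∀ {U c cs i} t → Represents f U t → (c ∷ cs) ⋖ U i → suc (f i) ≤ rest t c cs
    rest-upper nil rep c⋖ = prio-upper f rep (nonEmpty c⋖)
    rest-upper {U} {c} {cs} {i} (node d p sp l m r) rep c⋖ with compare c d
    ... | tri< _ _ _ = prio-upper f rep (nonEmpty c⋖)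
    ... | tri> _ _ _ = prio-upper f rep (nonEmpty c⋖)
    rest-upper {cs = []} (node d p sp l m r) rep c⋖ | tri≈ _ refl _ with ⋖-cases c⋖
    ... | inj₁ above-c = ≤-trans (prio-upper f (represents-above f rep) above-c) (m≤n⊔m (prio l) (prio r))
    rest-upper {cs = c′ ∷ cs} (node d p sp l m r) rep c⋖ | tri≈ _ refl _ with ⋖-cases c⋖
    ... | inj₁ above-c = ≤-trans (prio-upper f (represents-above f rep) above-c)
                           (≤-trans (m≤n⊔m (prio l) (prio r)) (m≤m⊔n _ _))
    ... | inj₂ h       = ≤-trans (rest-upper m (represents-under f rep) h) (m≤n⊔m (prio l ℕ.⊔ prio r) _)

    -- The base B stands for the strings that diverge at a later character.

    spine-bound : ∀ {b} {B : Pred (Fin n) b} (B? : Decidable B) {W p} t →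
      Represents f W t → Embeds W → (∀ {i} → B i → suc (f i) ≤ p) →
      (∀ {i j} → B i → NonEmpty (W j) → S i ⋖ S j) →
      spine t p + records f 0 (filter B? L) ≤
      records f 0 (filter (λ i → B? i ⊎-dec nonEmpty? (W i)) L)
    spine-bound B? nil rep emb B≤ B≺ = Step.count-⊆ B? _ inj₁
      (λ { _ (inj₁ b) ¬b → contradiction b ¬b ; b (inj₂ w) _ → B≺ b w })
    spine-bound B? {W} {p} (node e q sq l m r) rep emb B≤ B≺ with p <ᵇ q in eq
    ... | false = Step.count-⊆ B? _ inj₁
      (λ { _ (inj₁ b) ¬b → contradiction b ¬b ; b (inj₂ w) _ → B≺ b w })
    ... | true  = ≤-trans
        (s≤s (spine-bound B? l (represents-below f rep) (embeds-below emb) B≤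
          (λ {_} {j} b → B≺ b ∘ nonEmpty-below (W j))))
        (Step.count-⊂ (λ i → B? i ⊎-dec nonEmpty? (below e (W i))) (λ i → B? i ⊎-dec nonEmpty? (W i))
          (λ {j} → map₂ (nonEmpty-below (W j)))
          ≺-rest k (inj₂ (e , _ , Wk)) [ k∉B , ¬head-below Wk ]′
          [ (λ b → s≤s⁻¹ (≤-trans (B≤ b) (≤-trans (<⇒≤ p<q) (≤-reflexive q≡))))
          , (λ w → s≤s⁻¹ (≤-trans (prio-upper f (represents-below f rep) w)
                            (≤-trans (proj₁ (heap here)) (≤-reflexive q≡)))) ]′)
      where
      open Represents rep
      k = proj₁ (attained here)
      q≡ : q ≡ suc (f k)
      q≡ = proj₂ (proj₂ (attained here))
      Wk : W k ≡ e ∷ proj₁ (⊑-head (proj₁ (proj₂ (attained here))))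
      Wk = proj₂ (⊑-head (proj₁ (proj₂ (attained here))))
      p<q : p < q
      p<q = <ᵇ⇒< p q (subst T (sym eq) _)
      -- A sinking step requires `p < q`, which both keeps `k` outside the base and puts its
      -- priority above those of the base.
      k∉B : ¬ _
      k∉B b = <⇒≱ p<q (≤-trans (≤-reflexive q≡) (B≤ b))
      ≺-rest : ∀ {i j} → _ → _ → _ → S i ⋖ S j
      ≺-rest i∈ (inj₁ b) j∉ = contradiction (inj₁ b) j∉
      ≺-rest (inj₁ b) (inj₂ w) j∉ = B≺ b w
      ≺-rest {i} (inj₂ (x , xs , eq)) (inj₂ w) j∉ =
        let Wi , x≺e = below⁻ (W i) eq
            _ , _ , Wj , x≺y = ≺-not-below x≺e w (j∉ ∘ inj₂)
        in emb (this′ Wi Wj x≺y)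

    -- The strings to the right of `d ∷ cs` diverge at `d` or later, and the later ones come first.
    -- Spine nodes have priorities above `p′`, hence above those of all later ones, so the two
    -- counts add up.
    level-bound : ∀ {U d p sp l m r} → Represents f U (node d p sp l m r) → Embeds U → ∀ {cs p′} →
      (∀ {i} → cs ⋖ under d (U i) → suc (f i) ≤ p′) →
      spine r p′ + count cs (under d ∘ U) ≤ count (d ∷ cs) U
    level-bound {U} {d} {r = r} rep emb {cs} under≤ = ≤-trans
      (spine-bound (λ i → cs ⋖? under d (U i)) {above d ∘ U} r (represents-above f rep) (embeds-above emb) under≤
        (λ {i} {j} i∈ (x , xs , eq) →
          let Uj , d≺x = above⁻ (U j) eq in emb (this′ (proj₂ (proj₂ (under-⋖ (U i) i∈))) Uj d≺x)))
      (Step.count-⊆ _ (λ i → (d ∷ cs) ⋖? U i)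
        (λ {i} → [ proj₁ ∘ under-⋖ (U i) , this-above (U i) ]′)
        (λ _ j∈ j∉ → contradiction (⊎-swap (⋖-cases j∈)) j∉))
      where
      this-above : ∀ u → NonEmpty (above d u) → (d ∷ cs) ⋖ u
      this-above u (x , xs , eq) = let eq′ , d≺x = above⁻ u eq in this′ refl eq′ d≺x

    sinks-bound : ∀ {U c cs} t → Represents f U t → Embeds U → sinks t c cs ≤ count (c ∷ cs) U
    sinks-bound nil rep emb = z≤n
    sinks-bound {U} {c} {cs} (node d p sp l m r) rep emb with compare c d
    ... | tri< _ _ _   = ≤-trans (sinks-bound l (represents-below f rep) (embeds-below emb)) (below-step emb)
    ... | tri> _ _ d≺c = ≤-trans (sinks-bound r (represents-above f rep) (embeds-above emb)) (above-step d≺c)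
    sinks-bound {cs = []} (node d p sp l m r) rep emb | tri≈ _ refl _ =
      -- No string diverges from an empty remainder, so the base is empty and the threshold 0 is
      -- admissible.
      ≤-trans (m≤m+n _ _) (level-bound rep emb {[]} λ ())
    sinks-bound {cs = c′ ∷ cs} (node d p sp l m r) rep emb | tri≈ _ refl _ =
      ≤-trans (+-monoʳ-≤ (spine r (rest m c′ cs)) (sinks-bound m (represents-under f rep) (embeds-under emb)))
        (level-bound rep emb (rest-upper m (represents-under f rep)))

-- Mirrored tries

module Cost {a ℓ} {A : Set a} {_≺_ : Rel A ℓ} (sto : IsStrictTotalOrder _≡_ _≺_) where

  open IsStrictTotalOrder sto using (compare)

  flip-sto : IsStrictTotalOrder _≡_ (flip _≺_)
  flip-sto = Flip.isStrictTotalOrder sto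

  open RTrie sto
  open Right sto
  module Mir = RTrie flip-sto
  module Left = Right flip-sto

  mirror : Trie → Mir.Trie
  mirror nil                 = Mir.nil
  mirror (node d p sp l m r) = Mir.node d p sp (mirror r) (mirror m) (mirror l)

  prio-mirror : ∀ t → Mir.prio (mirror t) ≡ prio t
  prio-mirror nil                = refl
  prio-mirror (node _ _ _ _ _ _) = refl

  mirror-∋ : ∀ {t w x} → t ∋ w ↦ x → mirror t Mir.∋ w ↦ mirror x
  mirror-∋ here      = Mir.here
  mirror-∋ (left h)  = Mir.right (mirror-∋ h)
  mirror-∋ (mid h)   = Mir.mid (mirror-∋ h)
  mirror-∋ (right h) = Mir.left (mirror-∋ h)

  mirror-∋⁻ : ∀ t {w y} → mirror t Mir.∋ w ↦ y → ∃[ x ] (y ≡ mirror x × t ∋ w ↦ x)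
  mirror-∋⁻ (node d p sp l m r) Mir.here      = _ , refl , here
  mirror-∋⁻ (node d p sp l m r) (Mir.left h)  = let x , eq , h′ = mirror-∋⁻ r h in x , eq , right h′
  mirror-∋⁻ (node d p sp l m r) (Mir.mid h)   = let x , eq , h′ = mirror-∋⁻ m h in x , eq , mid h′
  mirror-∋⁻ (node d p sp l m r) (Mir.right h) = let x , eq , h′ = mirror-∋⁻ l h in x , eq , left h′

  mirror-siblings : ∀ {p} {P : A → Set p} {t} → AllSiblings P t → Mir.AllSiblings P (mirror t)
  mirror-siblings nil           = Mir.nil
  mirror-siblings (node pd l r) = Mir.node pd (mirror-siblings r) (mirror-siblings l)

  module _ {n} {f : Fin n → ℕ} {U : Fin n → List A} {t} (rep : Represents f U t) where

    open Represents rep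

    mirror-represents : Left.Represents f U (mirror t)
    mirror-represents = record
      { ordered  = ordered′
      ; complete = λ i w⊑ → let x , h = complete i w⊑ in mirror x , mirror-∋ h
      ; upper    = upper′
      ; attained = attained′
      ; heap     = heap′
      }
      where
      ordered′ : ∀ {w d p sp l m r} → mirror t Mir.∋ w ↦ Mir.node d p sp l m r →
                 Mir.AllSiblings (d ≺_) l × Mir.AllSiblings (_≺ d) r
      ordered′ h with mirror-∋⁻ t h
      ... | node _ _ _ _ _ _ , refl , h′ =
        let l , r = ordered h′ in mirror-siblings r , mirror-siblings l
      upper′ : ∀ {w d p sp l m r} → mirror t Mir.∋ w ↦ Mir.node d p sp l m r →
               ∀ i → w ⊑ U i → suc (f i) ≤ p
      upper′ h with mirror-∋⁻ t h
      ... | node _ _ _ _ _ _ , refl , h′ = upper h′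
      attained′ : ∀ {w d p sp l m r} → mirror t Mir.∋ w ↦ Mir.node d p sp l m r →
                  ∃ λ i → w ⊑ U i × p ≡ suc (f i)
      attained′ h with mirror-∋⁻ t h
      ... | node _ _ _ _ _ _ , refl , h′ = attained h′
      heap′ : ∀ {w d p sp l m r} → mirror t Mir.∋ w ↦ Mir.node d p sp l m r →
              Mir.prio l ≤ p × Mir.prio r ≤ p
      heap′ h with mirror-∋⁻ t h
      ... | node _ _ _ l _ r , refl , h′ rewrite prio-mirror l | prio-mirror r = swap (heap h′)

  -- `rest` treats both siblings alike, so one lower bound controls the sinking on both sides.
  rest-mirror : ∀ t c cs → Left.rest (mirror t) c cs ≡ rest t c cs
  rest-mirror nil c cs = refl
  rest-mirror (node d p sp l m r) c cs with compare c d
  ... | tri< _ _ _ = refl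
  ... | tri> _ _ _ = refl
  rest-mirror (node d p sp l m r) c [] | tri≈ _ _ _
    rewrite prio-mirror l | prio-mirror r = ⊔-comm (prio r) (prio l)
  rest-mirror (node d p sp l m r) c (c′ ∷ cs) | tri≈ _ _ _
    rewrite prio-mirror l | prio-mirror r | rest-mirror m c′ cs = cong (ℕ._⊔ _) (⊔-comm (prio r) (prio l))

  prio-heapify : ∀ d p sp l m r →
    (prio l ℕ.⊔ prio r) ℕ.⊔ p ≤ prio (value (heapifyOrDelete d p sp l m r))
  prio-heapify d p sp l m r
    with p <ᵇ prio l in p<l | p <ᵇ prio r in p<r | prio r <ᵇ prio l in r<l
  ... | false | false | _ = ≤-trans (⊔-lub (⊔-lub (<ᵇ-false p (prio l) p<l) (<ᵇ-false p (prio r) p<r)) ≤-refl)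
                                  (kept p)
    where
    kept : ∀ p → p ≤ prio (if does (p ≟ 0) then nil else node d p sp l m r)
    kept zero    = z≤n
    kept (suc p) = ≤-refl
  prio-heapify d p sp l@(node _ _ _ _ _ _) m r | true | _ | true =
    ⊔-lub (⊔-lub ≤-refl (<⇒≤ (<ᵇ-true (prio r) (prio l) r<l))) (<⇒≤ (<ᵇ-true p (prio l) p<l))
  prio-heapify d p sp l@(node _ _ _ _ _ _) m r | false | true | true =
    ⊔-lub (⊔-lub ≤-refl (<⇒≤ (<ᵇ-true (prio r) (prio l) r<l)))
      (≤-trans (<⇒≤ (<ᵇ-true p (prio r) p<r)) (<⇒≤ (<ᵇ-true (prio r) (prio l) r<l)))
  prio-heapify d p sp l m r@(node _ _ _ _ _ _) | true | true | false =
    ⊔-lub (⊔-lub (<ᵇ-false (prio r) (prio l) r<l) ≤-refl) (<⇒≤ (<ᵇ-true p (prio r) p<r))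
  prio-heapify d p sp l m r@(node _ _ _ _ _ _) | false | true | false =
    ⊔-lub (⊔-lub (<ᵇ-false (prio r) (prio l) r<l) ≤-refl) (<⇒≤ (<ᵇ-true p (prio r) p<r))
  prio-heapify d p sp l m r | true | false | false =
    contradiction (<ᵇ-false p (prio r) p<r)
      (<⇒≱ (<-≤-trans (<ᵇ-true p (prio l) p<l) (<ᵇ-false (prio r) (prio l) r<l)))

  rest≤prio-delete : ∀ c cs t → rest t c cs ≤ prio (value (deleteFrom c cs t))
  rest≤prio-delete c cs nil = z≤n
  rest≤prio-delete c cs (node d p sp l m r) with compare c d
  ... | tri< _ _ _ = ≤-refl
  ... | tri> _ _ _ = ≤-refl
  rest≤prio-delete c [] (node d p sp l m r) | tri≈ _ _ _ =
    ≤-trans (m≤m⊔n _ _) (prio-heapify d (prio m) 0 l m r)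
  rest≤prio-delete c (c′ ∷ cs) (node d p sp l m r) | tri≈ _ _ _ =
    ≤-trans (⊔-monoʳ-≤ (prio l ℕ.⊔ prio r) (≤-trans (rest≤prio-delete c′ cs m) (m≤n⊔m sp _)))
      (prio-heapify d _ sp l _ r)

  -- Running times

  decide-≤ : ∀ m n {m≤n : True (m ≤? n)} → m ≤ n
  decide-≤ m n {m≤n} = toWitness m≤n

  mutual

    -- A sinking step costs 13 operations for comparisons and 10 for the rotation with its recursive
    -- call. It shortens one spine by a node: rotating with the left child leaves the right subtree
    -- of that child as the new left subtree.
    heapify-time : ∀ d p sp l m r →
      time (heapifyOrDelete d p sp l m r) ≤ 23 + 23 * (Left.spine (mirror l) p + spine r p)
    heapify-time d p sp l m r
      with p <ᵇ prio l in p<l | p <ᵇ prio r in p<r | prio r <ᵇ prio l in r<l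
    ... | false | false | _     = ≤-trans (decide-≤ 10 23) (m≤m+n 23 _)
    ... | true  | false | false = contradiction (<ᵇ-false p (prio r) p<r)
      (<⇒≱ (<-≤-trans (<ᵇ-true p (prio l) p<l) (<ᵇ-false (prio r) (prio l) r<l)))
    ... | false | true  | true  = contradiction (<ᵇ-false p (prio l) p<l)
      (<⇒≱ (<-trans (<ᵇ-true p (prio r) p<r) (<ᵇ-true (prio r) (prio l) r<l)))
    ... | true  | true  | true  = +-monoʳ-≤ 13 (sinkRight-time d p sp l m r p<l)
    ... | true  | false | true  = +-monoʳ-≤ 13 (sinkRight-time d p sp l m r p<l)
    ... | true  | true  | false = +-monoʳ-≤ 13 (sinkLeft-time d p sp l m r p<r)
    ... | false | true  | false = +-monoʳ-≤ 13 (sinkLeft-time d p sp l m r p<r)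

    sinkRight-time : ∀ d p sp l m r → (p <ᵇ prio l) ≡ true →
      time (sinkRight d p sp l m r) ≤ 10 + 23 * (Left.spine (mirror l) p + spine r p)
    sinkRight-time d p sp (node e q sq l m′ r′) m r p<q rewrite p<q = begin
      6 + (1 + ((2 + H) + (1 + 0))) ≡⟨ ticks H ⟩
      10 + H                        ≤⟨ +-monoʳ-≤ 10 (heapify-time d p sp r′ m r) ⟩
      10 + (23 + 23 * X)            ≡⟨ cong (10 +_) (*-suc 23 X) ⟨
      10 + 23 * suc X               ∎
      where
      open ≤-Reasoning
      H = time (heapifyOrDelete d p sp r′ m r)
      X = Left.spine (mirror r′) p + spine r p
      ticks : ∀ H → 6 + (1 + ((2 + H) + (1 + 0))) ≡ 10 + H
      ticks = solve-∀

    sinkLeft-time : ∀ d p sp l m r → (p <ᵇ prio r) ≡ true →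
      time (sinkLeft d p sp l m r) ≤ 10 + 23 * (Left.spine (mirror l) p + spine r p)
    sinkLeft-time d p sp l m (node e q sq l′ m′ r) p<q rewrite p<q = begin
      6 + (1 + ((2 + H) + (1 + 0))) ≡⟨ ticks H ⟩
      10 + H                        ≤⟨ +-monoʳ-≤ 10 (heapify-time d p sp l m l′) ⟩
      10 + (23 + 23 * (X + Y))
        ≡⟨ cong (10 +_) (trans (sym (*-suc 23 (X + Y))) (cong (23 *_) (sym (+-suc X Y)))) ⟩
      10 + 23 * (X + suc Y)         ∎
      where
      open ≤-Reasoning
      H = time (heapifyOrDelete d p sp l m l′)
      X = Left.spine (mirror l) p
      Y = spine l′ p
      ticks : ∀ H → 6 + (1 + ((2 + H) + (1 + 0))) ≡ 10 + H
      ticks = solve-∀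

  -- 50 exceeds the cost of every single step of the three operations.

  grow : ∀ δ y {T} {δ≤ : True (δ ≤? 50)} → T ≤ 50 * y → δ + T ≤ 50 * suc y
  grow δ y {δ≤ = δ≤} T≤ = ≤-trans (+-mono-≤ (decide-≤ δ 50 {δ≤}) T≤) (≤-reflexive (sym (*-suc 50 y)))

  searchTurns : A → List A → Trie → ℕ
  searchTurns c cs t = turns t c cs + Left.turns (mirror t) c cs

  searchFrom-time : ∀ c cs t → time (searchFrom c cs t) ≤ 50 * suc (List.length cs + searchTurns c cs t)
  searchFrom-time c cs nil = grow 1 (List.length cs + 0) z≤n
  searchFrom-time c cs (node d p sp l m r) with compare c d
  ... | tri< _ _ _ = ≤-trans (grow 5 (suc (List.length cs + searchTurns c cs l)) (searchFrom-time c cs l))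
    (≤-reflexive (cong (λ x → 50 * suc x) (sym (+-suc (List.length cs) (searchTurns c cs l)))))
  ... | tri> _ _ _ = ≤-trans (grow 8 (suc (List.length cs + searchTurns c cs r)) (searchFrom-time c cs r))
    (≤-reflexive (cong (50 *_) (shift (List.length cs) (turns r c cs) (Left.turns (mirror r) c cs))))
    where
    shift : ∀ k x y → 2 + (k + (x + y)) ≡ suc (k + (x + suc y))
    shift = solve-∀
  searchFrom-time c []        (node d p sp l m r) | tri≈ _ _ _ = decide-≤ 10 50
  searchFrom-time c (c′ ∷ cs) (node d p sp l m r) | tri≈ _ _ _ =
    grow 10 (suc (List.length cs + searchTurns c′ cs m)) (searchFrom-time c′ cs m)

  if-≤ : ∀ {x} {X : Set x} b {u v : Timed X} {k} → time u ≤ k → time v ≤ k → time (if b then u else v) ≤ k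
  if-≤ true  u≤ v≤ = u≤
  if-≤ false u≤ v≤ = v≤

  rotateWithLeft-time : ∀ t → time (rotateWithLeft t) ≤ 4
  rotateWithLeft-time nil                                      = z≤n
  rotateWithLeft-time (node _ _ _ nil _ _)                     = z≤n
  rotateWithLeft-time (node _ _ _ (node _ _ _ _ _ _) _ _)      = ≤-refl

  rotateWithRight-time : ∀ t → time (rotateWithRight t) ≤ 4
  rotateWithRight-time nil                                     = z≤n
  rotateWithRight-time (node _ _ _ _ _ nil)                    = z≤n
  rotateWithRight-time (node _ _ _ _ _ (node _ _ _ _ _ _))     = ≤-refl

  insertNil-time : ∀ q c cs → time (insertFrom q c cs nil) ≤ 50 * suc (List.length cs)
  insertNil-time q c []        = decide-≤ 25 50
  insertNil-time q c (c′ ∷ cs) = begin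
    1 + (7 + (7 + (1 + (2 + ((2 + H) + (1 + (5 + 0))))))) ≡⟨ ticks H ⟩
    26 + H                                         ≤⟨ grow 26 (suc (List.length cs)) (insertNil-time q c′ cs) ⟩
    50 * suc (suc (List.length cs))                ∎
    where
    open ≤-Reasoning
    H = time (insertFrom q c′ cs nil)
    ticks : ∀ H → 1 + (7 + (7 + (1 + (2 + ((2 + H) + (1 + (5 + 0))))))) ≡ 26 + H
    ticks = solve-∀

  -- Rotations happen while the recursion returns, at most one at each node of the search path, so
  -- they are charged to the steps of the search.
  insertFrom-time : ∀ q c cs t → time (insertFrom q c cs t) ≤ 50 * suc (List.length cs + searchTurns c cs t)
  insertFrom-time q c cs nil = ≤-trans (insertNil-time q c cs) (*-monoʳ-≤ 50 (s≤s (m≤m+n _ 0)))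
  insertFrom-time q c cs (node d p sp l m r) with compare c d
  ... | tri< _ _ _ = begin
    4 + (1 + ((2 + H) + (5 + X))) ≤⟨ +-monoʳ-≤ 4 (+-monoʳ-≤ 1 (+-monoʳ-≤ (2 + H) (+-monoʳ-≤ 5 X≤6))) ⟩
    4 + (1 + ((2 + H) + (5 + 6))) ≡⟨ ticks H ⟩
    18 + H                        ≤⟨ grow 18 (suc (List.length cs + searchTurns c cs l)) (insertFrom-time q c cs l) ⟩
    50 * (2 + (List.length cs + searchTurns c cs l)) ≡⟨ cong (λ x → 50 * suc x) (+-suc (List.length cs) _) ⟨
    50 * suc (List.length cs + suc (searchTurns c cs l)) ∎
    where
    open ≤-Reasoning
    H = time (insertFrom q c cs l)
    l′ = value (insertFrom q c cs l)
    X = time (if does (p <? prio l′) then call (rotateWithLeft (node d p sp l′ m r))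
              else return (node d p sp l′ m r))
    X≤6 : X ≤ 6
    X≤6 = if-≤ (does (p <? prio l′)) (+-monoʳ-≤ 2 (rotateWithLeft-time (node d p sp l′ m r))) z≤n
    ticks : ∀ H → 4 + (1 + ((2 + H) + (5 + 6))) ≡ 18 + H
    ticks = solve-∀
  ... | tri> _ _ _ = begin
    7 + (1 + ((2 + H) + (5 + X))) ≤⟨ +-monoʳ-≤ 7 (+-monoʳ-≤ 1 (+-monoʳ-≤ (2 + H) (+-monoʳ-≤ 5 X≤6))) ⟩
    7 + (1 + ((2 + H) + (5 + 6))) ≡⟨ ticks H ⟩
    21 + H                        ≤⟨ grow 21 (suc (List.length cs + searchTurns c cs r)) (insertFrom-time q c cs r) ⟩
    50 * (2 + (List.length cs + searchTurns c cs r))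
      ≡⟨ cong (λ x → 50 * suc x)
           (trans (cong (List.length cs +_) (+-suc (turns r c cs) _)) (+-suc (List.length cs) _)) ⟨
    50 * suc (List.length cs + (turns r c cs + suc (Left.turns (mirror r) c cs))) ∎
    where
    open ≤-Reasoning
    H = time (insertFrom q c cs r)
    r′ = value (insertFrom q c cs r)
    X = time (if does (p <? prio r′) then call (rotateWithRight (node d p sp l m r′))
              else return (node d p sp l m r′))
    X≤6 : X ≤ 6
    X≤6 = if-≤ (does (p <? prio r′)) (+-monoʳ-≤ 2 (rotateWithRight-time (node d p sp l m r′))) z≤n
    ticks : ∀ H → 7 + (1 + ((2 + H) + (5 + 6))) ≡ 21 + H
    ticks = solve-∀
  insertFrom-time q c [] (node d p sp l m r) | tri≈ _ _ _ = begin
    7 + (1 + (2 + (X + (5 + 0))))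
      ≤⟨ +-monoʳ-≤ 10 (+-monoˡ-≤ 5 (if-≤ (does (sp ≟ 0)) {q inTime 2} {return sp} ≤-refl z≤n)) ⟩
    17                            ≤⟨ decide-≤ 17 50 ⟩
    50 ∎
    where
    open ≤-Reasoning
    X = time (if does (sp ≟ 0) then q inTime 2 else return sp)
  insertFrom-time q c (c′ ∷ cs) (node d p sp l m r) | tri≈ _ _ _ = begin
    7 + (1 + (2 + ((2 + H) + (1 + (5 + 0))))) ≡⟨ ticks H ⟩
    18 + H                                    ≤⟨ grow 18 (suc (List.length cs + searchTurns c′ cs m)) (insertFrom-time q c′ cs m) ⟩
    50 * suc (suc (List.length cs + searchTurns c′ cs m)) ∎
    where
    open ≤-Reasoning
    H = time (insertFrom q c′ cs m)
    ticks : ∀ H → 7 + (1 + (2 + ((2 + H) + (1 + (5 + 0))))) ≡ 18 + H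
    ticks = solve-∀

  deleteSteps : A → List A → Trie → ℕ
  deleteSteps c cs t = searchTurns c cs t + (Left.sinks (mirror t) c cs + sinks t c cs)

  deleteFrom-time : ∀ c cs t → time (deleteFrom c cs t) ≤ 50 * suc (List.length cs + deleteSteps c cs t)
  deleteFrom-time c cs nil = grow 1 (List.length cs + 0) z≤n
  deleteFrom-time c cs (node d p sp l m r) with compare c d
  ... | tri< _ _ _ = begin
    4 + (1 + ((2 + H) + (1 + 0)))                    ≡⟨ ticks H ⟩
    8 + H                                            ≤⟨ grow 8 (suc (List.length cs + deleteSteps c cs l)) (deleteFrom-time c cs l) ⟩
    50 * (2 + (List.length cs + deleteSteps c cs l)) ≡⟨ cong (λ x → 50 * suc x) (+-suc (List.length cs) _) ⟨
    50 * suc (List.length cs + suc (deleteSteps c cs l)) ∎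
    where
    open ≤-Reasoning
    H = time (deleteFrom c cs l)
    ticks : ∀ H → 4 + (1 + ((2 + H) + (1 + 0))) ≡ 8 + H
    ticks = solve-∀
  ... | tri> _ _ _ = begin
    7 + (1 + ((2 + H) + (1 + 0)))                    ≡⟨ ticks H ⟩
    11 + H                                           ≤⟨ grow 11 (suc (List.length cs + deleteSteps c cs r)) (deleteFrom-time c cs r) ⟩
    50 * (2 + (List.length cs + deleteSteps c cs r))
      ≡⟨ cong (50 *_) (shift (List.length cs) (turns r c cs) (Left.turns (mirror r) c cs) _) ⟩
    50 * suc (List.length cs + (turns r c cs + suc (Left.turns (mirror r) c cs) + _)) ∎
    where
    open ≤-Reasoning
    H = time (deleteFrom c cs r)
    ticks : ∀ H → 7 + (1 + ((2 + H) + (1 + 0))) ≡ 11 + H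
    ticks = solve-∀
    shift : ∀ k x y z → 2 + (k + (x + y + z)) ≡ suc (k + (x + suc y + z))
    shift = solve-∀
  deleteFrom-time c [] (node d p sp l m r) | tri≈ _ _ _ = begin
    7 + (1 + (1 + (5 + (2 + H))))
      ≤⟨ +-monoʳ-≤ 16 (≤-trans (heapify-time d (prio m) 0 l m r)
           (+-monoʳ-≤ 23 (*-monoʳ-≤ 23 (+-mono-≤ (Left.spine-anti (mirror l) z≤n) (spine-anti r z≤n))))) ⟩
    16 + (23 + 23 * X)             ≤⟨ +-mono-≤ (decide-≤ 39 50) (*-monoˡ-≤ X (decide-≤ 23 50)) ⟩
    50 + 50 * X                    ≡⟨ *-suc 50 X ⟨
    50 * suc X ∎
    where
    open ≤-Reasoning
    H = time (heapifyOrDelete d (prio m) 0 l m r)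
    X = Left.spine (mirror l) 0 + spine r 0
  deleteFrom-time c (c′ ∷ cs) (node d p sp l m r) | tri≈ _ _ _ = begin
    7 + (1 + (2 + ((2 + H) + (1 + (5 + (2 + X)))))) ≡⟨ ticks H X ⟩
    20 + X + H                                      ≤⟨ +-mono-≤ (+-monoʳ-≤ 20 X≤) (deleteFrom-time c′ cs m) ⟩
    20 + (23 + 23 * Y) + 50 * suc (List.length cs + Z)
      ≤⟨ +-monoˡ-≤ _ (+-mono-≤ (decide-≤ 43 50) (*-monoˡ-≤ Y (decide-≤ 23 50))) ⟩
    50 + 50 * Y + 50 * suc (List.length cs + Z)
      ≡⟨ distrib (searchTurns c′ cs m) (Left.sinks (mirror m) c′ cs) (sinks m c′ cs)
           (Left.spine (mirror l) (Left.rest (mirror m) c′ cs)) (spine r (rest m c′ cs)) (List.length cs) ⟩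
    _ ∎
    where
    open ≤-Reasoning
    H = time (deleteFrom c′ cs m)
    p′ = sp ℕ.⊔ prio (value (deleteFrom c′ cs m))
    X = time (heapifyOrDelete d p′ sp l (value (deleteFrom c′ cs m)) r)
    Y = Left.spine (mirror l) (Left.rest (mirror m) c′ cs) + spine r (rest m c′ cs)
    Z = deleteSteps c′ cs m
    -- `p′` may exceed `rest` through the string that ends at this node or through extensions of s.
    -- A higher priority only shortens the spines.
    rest≤p′ : rest m c′ cs ≤ p′
    rest≤p′ = ≤-trans (rest≤prio-delete c′ cs m) (m≤n⊔m sp _)
    X≤ : X ≤ 23 + 23 * Y
    X≤ = ≤-trans (heapify-time d p′ sp l _ r) (+-monoʳ-≤ 23 (*-monoʳ-≤ 23 (+-mono-≤
      (Left.spine-anti (mirror l) (≤-trans (≤-reflexive (rest-mirror m c′ cs)) rest≤p′)) (spine-anti r rest≤p′))))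
    ticks : ∀ H X → 7 + (1 + (2 + ((2 + H) + (1 + (5 + (2 + X)))))) ≡ 20 + X + H
    ticks = solve-∀
    distrib : ∀ u a b x y k → 50 + 50 * (x + y) + 50 * suc (k + (u + (a + b))) ≡
      50 * suc (suc k + (u + ((x + a) + (y + b))))
    distrib = solve-∀

-- Strings in lexicographic order

module Maxima {a ℓ} {A : Set a} {_≺_ : Rel A ℓ} (sto : IsStrictTotalOrder _≡_ _≺_)
              {n} (S : Fin n → List A) where

  open IsStrictTotalOrder sto using () renaming (asym to ≺-asym; irrefl to ≺-irrefl)
  open Right sto

  private
    lexOrder : DecTotalOrder _ _ _
    lexOrder = On.decTotalOrder (Lex.≤-decTotalOrder (record { isStrictTotalOrder = sto })) S

    open Sort lexOrder using (sort; sort-↭; sort-↗)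

    lex⇒¬⋖ : ∀ {xs ys} → Lex-≤ _≡_ _≺_ xs ys → ¬ ys ⋖ xs
    lex⇒¬⋖ (this x≺y)    (this y≺x)  = ≺-asym x≺y y≺x
    lex⇒¬⋖ (this x≺x)    (next _)    = ≺-irrefl refl x≺x
    lex⇒¬⋖ (next refl _) (this x≺x)  = ≺-irrefl refl x≺x
    lex⇒¬⋖ (next _ h)    (next ys⋖xs) = lex⇒¬⋖ h ys⋖xs

  indices : List (Fin n)
  indices = sort (allFin n)

  sorted : AllPairs (λ i j → ¬ S j ⋖ S i) indices
  sorted = AllPairs.map lex⇒¬⋖ (Sorted⇒AllPairs (DecTotalOrder.totalOrder lexOrder) (sort-↗ (allFin n)))

  ∈-indices : ∀ i → i ∈ indices
  ∈-indices i = ∈-resp-↭ (↭-sym (sort-↭ (allFin n))) (∈-allFin i)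

  -- This sequence is determined by the strings alone, so it stays fixed while the priorities vary
  -- in `∑-maxima`.
  farther : List A → List (Fin n)
  farther s = filter (λ i → s ⋖? S i) indices

  farther! : ∀ s → Unique (farther s)
  farther! s = Unique.filter⁺ (λ i → s ⋖? S i)
    (Unique-resp-↭ (setoid (Fin n)) (↭⇒↭ₛ (↭-sym (sort-↭ (allFin n)))) (Unique.allFin⁺ n))

  length-farther : ∀ s → List.length (farther s) ≤ n
  length-farther s = ≤-trans (length-filter (λ i → s ⋖? S i) indices)
    (≤-reflexive (trans (↭-length (sort-↭ (allFin n))) (length-tabulate {n = n} id)))

  maxima : ∀ {r} → List⁺ A → Vec (Fin r) n → ℕ
  maxima s π = records (ranks π) 0 (farther (toList s))

  turns≤maxima : ∀ {r} (π : Vec (Fin r) n) {t} → Represents (ranks π) S t →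
                 ∀ c cs → turns t c cs ≤ maxima (c ∷ cs) π
  turns≤maxima π {t} rep c cs = turns-bound (ranks π) S indices ∈-indices sorted t rep id

  sinks≤maxima : ∀ {r} (π : Vec (Fin r) n) {t} → Represents (ranks π) S t →
                 ∀ c cs → sinks t c cs ≤ maxima (c ∷ cs) π
  sinks≤maxima π {t} rep c cs = sinks-bound (ranks π) S indices ∈-indices sorted t rep id

  ∑-maxima : ∀ {r} → 1 ≤ r → slack n ≤ r → ∀ s →
             ∑ (assignments n r) (λ π → 2 ^ maxima s π) ≤ (2 + n) * List.length (assignments n r)
  ∑-maxima {r} 1≤r s≤r s = ≤-trans
    (𝔼-bound₀ r (farther! (toList s)) (length-farther (toList s)) 1≤r s≤r)
    (≤-reflexive (trans (*-comm (r ^ n) (2 + n)) (cong ((2 + n) *_) (sym (length-assignments n r)))))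

-- From expectation to high probability

markov : ∀ {x p} {X : Set x} {P : Pred X p} (P? : Decidable P) (g : X → ℕ) {k} →
         (∀ ω → ¬ P ω → k ≤ g ω) → ∀ Ω → List.length (filter (¬? ∘ P?) Ω) * k ≤ ∑ Ω g
markov P? g bad []      = z≤n
markov P? g bad (ω ∷ Ω) with P? ω
... | yes _ = ≤-trans (markov P? g bad Ω) (m≤n+m _ (g ω))
... | no ¬p = +-mono-≤ (bad ω ¬p) (markov P? g bad Ω)

n<2^[1+log₂n] : ∀ n → n < 2 ^ suc ⌊log₂ n ⌋
n<2^[1+log₂n] n = ≰⇒> λ 2^≤n → 1+n≰n
  (≤-trans (≤-reflexive (sym (⌊log₂[2^n]⌋≡n (suc ⌊log₂ n ⌋)))) (⌊log₂⌋-mono-≤ 2^≤n))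

^-distribʳ-* : ∀ k m n → (m * n) ^ k ≡ m ^ k * n ^ k
^-distribʳ-* zero    m n = refl
^-distribʳ-* (suc k) m n =
  trans (cong (m * n *_) (^-distribʳ-* k m n)) (interchange m n (m ^ k) (n ^ k))
  where
  interchange : ∀ a b c d → a * b * (c * d) ≡ a * c * (b * d)
  interchange = solve-∀

-- 2 ^ (4 * ⌊log₂ n ⌋) absorbs the factor 2 * (2 + n) of Markov's inequality,
-- and n ≤ 2 ^ (2 * ⌊log₂ n ⌋) for n ≥ 2 explains the second summand.

exponent : ℚ → ℕ
exponent c = 4 + 2 * ∣ ↥ c ∣

withProbability : ∀ {x p} {X : Set x} {P : Pred X p} c n (Ω : List X) (P? : Decidable P) →
  1 ≤ n → (g : X → ℕ) → ∑ Ω g ≤ 2 * ((2 + n) * List.length Ω) →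
  (∀ ω → ¬ P ω → 2 ^ (exponent c * ⌊log₂ n ⌋) ≤ g ω) →
  (WithProbability≥1- n ^- c) Ω P?
-- Here the claimed probability is 0, and since the logarithm vanishes Markov's inequality would say
-- nothing.
withProbability c 1 Ω P? _ g _ _ = begin
  f ^ v * 1 ^ u ≡⟨ cong (f ^ v *_) (^-zeroˡ u) ⟩
  f ^ v * 1     ≡⟨ *-identityʳ (f ^ v) ⟩
  f ^ v         ≤⟨ ^-monoˡ-≤ v (length-filter (¬? ∘ P?) Ω) ⟩
  N ^ v         ∎
  where
  open ≤-Reasoning
  f = List.length (filter (¬? ∘ P?) Ω)
  N = List.length Ω
  u = ∣ ↥ c ∣
  v = ↧ₙ c
withProbability c n@(suc (suc k)) Ω P? _ g ∑g≤ bad = begin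
  f ^ v * n ^ u                  ≤⟨ *-monoʳ-≤ (f ^ v) n^u≤ ⟩
  f ^ v * (2 ^ (2 * u * lg)) ^ v ≡⟨ ^-distribʳ-* v f (2 ^ (2 * u * lg)) ⟨
  (f * 2 ^ (2 * u * lg)) ^ v     ≤⟨ ^-monoˡ-≤ v f≤ ⟩
  N ^ v                          ∎
  where
  open ≤-Reasoning
  f = List.length (filter (¬? ∘ P?) Ω)
  N = List.length Ω
  u = ∣ ↥ c ∣
  v = ↧ₙ c
  lg = ⌊log₂ n ⌋
  1≤lg : 1 ≤ lg
  1≤lg = ⌊log₂⌋-mono-≤ {2} {n} (s≤s (s≤s z≤n))
  n≤ : n ≤ 2 ^ (2 * lg)
  n≤ = ≤-trans (<⇒≤ (n<2^[1+log₂n] n)) (^-monoʳ-≤ 2 (+-mono-≤ 1≤lg (≤-reflexive (sym (+-identityʳ lg)))))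
  -- The proof aims at failure probability n^(-u), which is at most n^(-u/v) as `v` is positive. So
  -- only the numerator of `c` enters `exponent`.
  n^u≤ : n ^ u ≤ (2 ^ (2 * u * lg)) ^ v
  n^u≤ = begin
    n ^ u                  ≤⟨ ^-monoˡ-≤ u n≤ ⟩
    (2 ^ (2 * lg)) ^ u     ≡⟨ ^-*-assoc 2 (2 * lg) u ⟩
    2 ^ (2 * lg * u)       ≡⟨ cong (2 ^_) (rotate lg u) ⟩
    2 ^ (2 * u * lg)       ≤⟨ ^-monoʳ-≤ 2 (m≤m*n (2 * u * lg) v) ⟩
    2 ^ (2 * u * lg * v)   ≡⟨ ^-*-assoc 2 (2 * u * lg) v ⟨
    (2 ^ (2 * u * lg)) ^ v ∎
    where
    rotate : ∀ x y → 2 * x * y ≡ 2 * y * x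
    rotate = solve-∀
  4n≤ : 2 * ((2 + n) * N) ≤ N * 2 ^ (4 * lg)
  4n≤ = begin
    2 * ((2 + n) * N)         ≤⟨ *-monoʳ-≤ 2 (*-monoˡ-≤ N (+-monoˡ-≤ n (s≤s (s≤s (z≤n {k}))))) ⟩
    2 * ((n + n) * N)         ≡⟨ regroup n N ⟩
    N * (2 ^ 2 * n)           ≤⟨ *-monoʳ-≤ N (*-mono-≤ (^-monoʳ-≤ 2 (*-monoʳ-≤ 2 1≤lg)) n≤) ⟩
    N * (2 ^ (2 * lg) * 2 ^ (2 * lg)) ≡⟨ cong (N *_) (^-distribˡ-+-* 2 (2 * lg) (2 * lg)) ⟨
    N * 2 ^ (2 * lg + 2 * lg) ≡⟨ cong (λ e → N * 2 ^ e) (*-distribʳ-+ lg 2 2) ⟨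
    N * 2 ^ (4 * lg)          ∎
    where
    regroup : ∀ x y → 2 * ((x + x) * y) ≡ y * (4 * x)
    regroup = solve-∀
  f≤ : f * 2 ^ (2 * u * lg) ≤ N
  f≤ = *-cancelʳ-≤ _ _ (2 ^ (4 * lg)) {{m^n≢0 2 (4 * lg)}} (begin
    f * 2 ^ (2 * u * lg) * 2 ^ (4 * lg)   ≡⟨ *-assoc f _ _ ⟩
    f * (2 ^ (2 * u * lg) * 2 ^ (4 * lg)) ≡⟨ cong (f *_) (*-comm (2 ^ (2 * u * lg)) _) ⟩
    f * (2 ^ (4 * lg) * 2 ^ (2 * u * lg)) ≡⟨ cong (f *_) (^-distribˡ-+-* 2 (4 * lg) (2 * u * lg)) ⟨
    f * 2 ^ (4 * lg + 2 * u * lg)         ≡⟨ cong (λ e → f * 2 ^ e) (*-distribʳ-+ lg 4 (2 * u)) ⟨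
    f * 2 ^ (exponent c * lg)             ≤⟨ markov P? g bad Ω ⟩
    ∑ Ω g                                 ≤⟨ ∑g≤ ⟩
    2 * ((2 + n) * N)                     ≤⟨ 4n≤ ⟩
    N * 2 ^ (4 * lg)                      ∎)

-- An independent coordinate multiplies the sum and the number of outcomes alike. For an insertion
-- this coordinate is the random priority of s.
∑-proj₂ : ∀ {x y} {X : Set x} {Y : Set y} (xs : List X) (ys : List Y) (g : Y → ℕ) {k} →
  ∑ ys g ≤ 2 * (k * List.length ys) →
  ∑ (cartesianProduct xs ys) (g ∘ proj₂) ≤ 2 * (k * List.length (cartesianProduct xs ys))
∑-proj₂ xs ys g {k} ∑≤ = begin
  ∑ (cartesianProduct xs ys) (g ∘ proj₂) ≡⟨ ∑-cartesianProductWith _,_ (g ∘ proj₂) xs ys ⟩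
  ∑ xs (λ _ → ∑ ys g)                    ≡⟨ ∑-const (∑ ys g) xs ⟩
  List.length xs * ∑ ys g                ≤⟨ *-monoʳ-≤ (List.length xs) ∑≤ ⟩
  List.length xs * (2 * (k * List.length ys)) ≡⟨ regroup (List.length xs) k (List.length ys) ⟩
  2 * (k * (List.length xs * List.length ys)) ≡⟨ cong (λ m → 2 * (k * m)) (length-cartesianProductWith _,_ xs ys) ⟨
  2 * (k * List.length (cartesianProduct xs ys)) ∎
  where
  open ≤-Reasoning
  regroup : ∀ x k y → x * (2 * (k * y)) ≡ 2 * (k * (x * y))
  regroup = solve-∀

-- Turns and sinking steps, each on two sides, give four counts of at most `K * lg`. The 2 comes
-- from k + 1 ≤ 2k for the length k = `suc j`.
budget : ∀ j K lg {x y} → x ≤ K * lg → y ≤ K * lg →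
         50 * suc (suc j + ((x + y) + (y + x))) ≤ 50 * (2 + 4 * K) * (suc j + lg)
budget j K lg {x} {y} x≤ y≤ =
  ≤-trans (*-monoʳ-≤ 50 inner) (≤-reflexive (sym (*-assoc 50 (2 + 4 * K) (suc j + lg))))
  where
  open ≤-Reasoning
  M = K * lg
  regroup : ∀ j K lg →
    suc (suc j + ((K * lg + K * lg) + (K * lg + K * lg))) + (j + 2 * lg + 4 * K * suc j) ≡
    (2 + 4 * K) * (suc j + lg)
  regroup = solve-∀
  inner : suc (suc j + ((x + y) + (y + x))) ≤ (2 + 4 * K) * (suc j + lg)
  inner = begin
    suc (suc j + ((x + y) + (y + x)))
      ≤⟨ s≤s (+-monoʳ-≤ (suc j) (+-mono-≤ (+-mono-≤ x≤ y≤) (+-mono-≤ y≤ x≤))) ⟩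
    suc (suc j + ((M + M) + (M + M)))
      ≤⟨ m≤m+n (suc (suc j + ((M + M) + (M + M)))) (j + 2 * lg + 4 * K * suc j) ⟩
    suc (suc j + ((M + M) + (M + M))) + (j + 2 * lg + 4 * K * suc j)
      ≡⟨ regroup j K lg ⟩
    (2 + 4 * K) * (suc j + lg) ∎

-- Combining time bounds and tail bounds

module Analysis {a ℓ} {A : Set a} {_≺_ : Rel A ℓ} (sto : IsStrictTotalOrder _≡_ _≺_)
                {n} (S : Fin n → List⁺ A) where

  open RTrie sto
  open Right sto using (Represents)
  open Cost sto
  module R = Maxima sto (toList ∘ S)
  module L = Maxima flip-sto (toList ∘ S)

  total : ∀ {r} → List⁺ A → Vec (Fin r) n → ℕ
  total s π = (R.maxima s π + L.maxima s π) + (L.maxima s π + R.maxima s π)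

  module _ {r} (π : Vec (Fin r) n) {t} (isRTrie : IsRTrie S (priority ∘ lookup π) t) (c : A) (cs : List A) where

    open IsRTrie isRTrie
    open IsTernarySearchTrie isTernarySearchTrie

    private
      s : List⁺ A
      s = c ∷ cs

    represents : Represents (ranks π) (toList ∘ S) t
    represents = record
      { ordered  = ordered
      ; complete = λ {w} → complete {w}
      ; upper    = prio-upperBound
      ; attained = prio-attained
      ; heap     = heap
      }

    searchTurns≤ : searchTurns c cs t ≤ R.maxima s π + L.maxima s π
    searchTurns≤ = +-mono-≤ (R.turns≤maxima π represents c cs)
      (L.turns≤maxima π (mirror-represents represents) c cs)

    deleteSteps≤ : deleteSteps c cs t ≤ total s π
    deleteSteps≤ = +-mono-≤ searchTurns≤ (+-mono-≤
      (L.sinks≤maxima π (mirror-represents represents) c cs) (R.sinks≤maxima π represents c cs))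

    private
      enclose : ∀ {T x} → x ≤ total s π → T ≤ 50 * suc (List.length cs + x) →
                4 + T ≤ 50 * suc (length s + total s π)
      enclose {T} {x} x≤ T≤ = grow 4 (suc (List.length cs + total s π))
        (≤-trans T≤ (*-monoʳ-≤ 50 (s≤s (+-monoʳ-≤ (List.length cs) x≤))))

      closing : ∀ T → 1 + ((2 + T) + (1 + 0)) ≡ 4 + T
      closing = solve-∀

    search-time : time (search s t) ≤ 50 * suc (length s + total s π)
    search-time = ≤-trans (n≤1+n _) (enclose (≤-trans searchTurns≤ (m≤m+n _ _)) (searchFrom-time c cs t))

    insert-time : ∀ q → time (insert q s t) ≤ 50 * suc (length s + total s π)
    insert-time q = ≤-trans (≤-reflexive (closing _))
      (enclose (≤-trans searchTurns≤ (m≤m+n _ _)) (insertFrom-time q c cs t))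

    delete-time : time (delete s t) ≤ 50 * suc (length s + total s π)
    delete-time = ≤-trans (≤-reflexive (closing _)) (enclose deleteSteps≤ (deleteFrom-time c cs t))

  -- A large count on either side makes the sum large, so one use of Markov's inequality includes
  -- the union bound over the two sides.
  weight : ∀ {r} → List⁺ A → Vec (Fin r) n → ℕ
  weight s π = 2 ^ R.maxima s π + 2 ^ L.maxima s π

  ∑-weight : ∀ {r} → 1 ≤ r → slack n ≤ r → ∀ s →
             ∑ (assignments n r) (weight s) ≤ 2 * ((2 + n) * List.length (assignments n r))
  ∑-weight {r} 1≤r s≤r s = begin
    ∑ (assignments n r) (weight s)
      ≡⟨ ∑-+ (λ π → 2 ^ R.maxima s π) (λ π → 2 ^ L.maxima s π) (assignments n r) ⟩
    ∑ (assignments n r) (λ π → 2 ^ R.maxima s π) + ∑ (assignments n r) (λ π → 2 ^ L.maxima s π)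
      ≤⟨ +-mono-≤ (R.∑-maxima 1≤r s≤r s) (L.∑-maxima 1≤r s≤r s) ⟩
    B + B ≡⟨ cong (B +_) (+-identityʳ B) ⟨
    2 * B ∎
    where
    open ≤-Reasoning
    B = (2 + n) * List.length (assignments n r)

  slow⇒heavy : ∀ {r} {π : Vec (Fin r) n} s {T} K lg →
    T ≤ 50 * suc (length s + total s π) →
    ¬ T ≤ 50 * (2 + 4 * K) * (length s + lg) → 2 ^ (K * lg) ≤ weight s π
  slow⇒heavy {r} {π} s@(c ∷ cs) {T} K lg T≤ slow with R.maxima s π ≤? K * lg | L.maxima s π ≤? K * lg
  ... | no R≰  | _      = ≤-trans (^-monoʳ-≤ 2 (<⇒≤ (≰⇒> R≰))) (m≤m+n _ _)
  ... | yes _  | no L≰  = ≤-trans (^-monoʳ-≤ 2 (<⇒≤ (≰⇒> L≰))) (m≤n+m _ _)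
  ... | yes R≤ | yes L≤ = contradiction
    (≤-trans T≤ (budget (List.length cs) K lg R≤ L≤)) slow

  fast-whp : ∀ {x} {X : Set x} {r} c → 1 ≤ n → ∀ s (Ω : List X) (outcome : X → Vec (Fin r) n) →
    ∑ Ω (weight s ∘ outcome) ≤ 2 * ((2 + n) * List.length Ω) →
    (τ : X → ℕ) → (∀ ω → τ ω ≤ 50 * suc (length s + total s (outcome ω))) →
    (WithProbability≥1- n ^- c) Ω
      (λ ω → τ ω ≤? 50 * (2 + 4 * exponent c) * (length s + ⌊log₂ n ⌋))
  fast-whp c 1≤n s Ω outcome ∑≤ τ τ≤ = withProbability c n Ω
    (λ ω → τ ω ≤? 50 * (2 + 4 * exponent c) * (length s + ⌊log₂ n ⌋)) 1≤n (weight s ∘ outcome) ∑≤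
    (λ ω → slow⇒heavy {π = outcome ω} s {τ ω} (exponent c) ⌊log₂ n ⌋ (τ≤ ω))

theorem2 : ∀ {a ℓ} (c : ℚ) → Positive c →
    ∃[ C ] 0 < C × (∀ n → 1 ≤ n →
    ∃[ r₀ ] (∀ r → 1 ≤ r → r₀ ≤ r →
    ∀ {A : Set a} {_≺_ : Rel A ℓ} (≺-isStrictTotalOrder : IsStrictTotalOrder _≡_ _≺_) →
    let open RTrie ≺-isStrictTotalOrder in
    (S : Fin n → List⁺ A) → Injective _≡_ _≡_ S →
    (s : List⁺ A) →
    (T : Vec (Fin r) n → Trie) →
    (∀ π → IsRTrie S (priority ∘ lookup π) (T π)) →
    let bound = C * (length s + ⌊log₂ n ⌋) in
    (WithProbability≥1- n ^- c) (assignments n r)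
    (λ π → time (search s (T π)) ≤? bound)
    × (WithProbability≥1- n ^- c) (cartesianProduct (allFin r) (assignments n r))
    (λ (q , π) → time (insert (priority q) s (T π)) ≤? bound)
    × (WithProbability≥1- n ^- c) (assignments n r)
    (λ π → time (delete s (T π)) ≤? bound)))
-- `slack n`, exponential in `n`, serves as r₀: it makes ties rare enough for `𝔼-bound₀`.
theorem2 c _ = 50 * (2 + 4 * exponent c) , s≤s z≤n , λ n 1≤n → slack n ,
  λ r 1≤r r₀≤r sto S _ s@(x ∷ xs) T isRTrie →
  let open RTrie sto
      open Analysis sto S
      ∑≤ = ∑-weight 1≤r r₀≤r s
  in fast-whp c 1≤n s (assignments n r) id ∑≤
       (λ π → time (search s (T π))) (λ π → search-time π (isRTrie π) x xs)
   , fast-whp c 1≤n s (cartesianProduct (allFin r) (assignments n r)) proj₂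
       (∑-proj₂ (allFin r) (assignments n r) (weight s) {2 + n} ∑≤)
       (λ (q , π) → time (insert (priority q) s (T π)))
       (λ (q , π) → insert-time π (isRTrie π) x xs (priority q))
   , fast-whp c 1≤n s (assignments n r) id ∑≤
       (λ π → time (delete s (T π))) (λ π → delete-time π (isRTrie π) x xs)
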